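{- Let $H$ be a directed graph with at least two arcs. For every arc-weighted directed multigraph $D$, $$\tau_H(D) \le f(H)\,\nu_H^*(D).$$
   Context: Directed graphs have no loops and no parallel arcs but may contain directed 2-cycles; directed multigraphs may additionally have parallel arcs in the same direction. An arc-weighted directed multigraph $D$ has a non-negative weight $w(e)$ on each arc. An $H$-copy in $D$ is a subgraph of $D$ isomorphic to $H$. $\tau_H(D)$ is the minimum total weight of a set $F$ of arcs such that deleting $F$ from $D$ leaves no $H$-copy. A fractional $H$-packing is a function $m$ from the set of $H$-copies of $D$ to $[0,\infty)$ such that for every arc $e$, the sum of $m(X)$ over $H$-copies $X$ containing $e$ is at most $w(e)$; $\nu_H^*(D)$ is the maximum of $\sum_X m(X)$ over fractional $H$-packings. For a directed graph $L$, the blowup $B(L)$ is obtained by replacing each vertex $v$ of $L$ by a countably infinite independent set $I_v$ and putting all arcs from $I_a$ to $I_b$ whenever $(a,b)\in E(L)$. ${\rm disc}_H(L)$ is the minimum number of arcs that must be added to $B(L)$ so that the resulting directed graph contains a copy of $H$. Define $$f(H,L)=\max\left\{|E(H)|\left(1-\frac{|E(L)|}{|V(L)|^2}\right),\; |E(H)|-{\rm disc}_H(L)\right\},\qquad f(H)=\inf_L f(H,L),$$ the infimum taken over all nonempty (i.e. having at least one arc) directed graphs $L$.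
   Formalization: The arc weights of D (and the values of the fractional packing) are rational numbers rather than arbitrary non-negative reals. -}

module Defs where

open import Data.Bool using (Bool; true; false; if_then_else_)
open import Data.Nat as ℕ using (ℕ; zero; suc; _≤_)
open import Data.Integer using (+_)
open import Data.Fin using (Fin)
open import Data.Fin.Subset using (Subset; inside; outside)
open import Data.Vec using (Vec; []; _∷_; lookup)
open import Data.List using (List; length)
open import Data.List.Membership.Propositional using (_∈_)
open import Data.List.Relation.Unary.All using (All)
open import Data.List.Relation.Unary.Unique.Propositional using (Unique)
open import Data.Product using (Σ; ∃; ∃-syntax; _×_; _,_; proj₁; proj₂)
open import Data.Sum using (_⊎_)
open import Data.Rational as ℚ using (ℚ; 0ℚ; 1ℚ; _+_; _*_; _-_; _⊔_)
open import Relation.Nullary using (¬_)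
open import Relation.Binary.PropositionalEquality using (_≡_; _≢_)
open import Function using (_⇔_)
open import Function.Definitions using (Injective)

∑ : (n : ℕ) → (Fin n → ℕ) → ℕ
∑ zero    f = 0
∑ (suc n) f = f Fin.zero ℕ.+ ∑ n (λ i → f (Fin.suc i))
  where import Data.Fin as Fin

∑ℚ : (n : ℕ) → (Fin n → ℚ) → ℚ
∑ℚ zero    f = 0ℚ
∑ℚ (suc n) f = f Fin.zero + ∑ℚ n (λ i → f (Fin.suc i))
  where import Data.Fin as Fin

∑Sub : (n : ℕ) → (Subset n → ℚ) → ℚ
∑Sub zero    f = f []
∑Sub (suc n) f = ∑Sub n (λ s → f (outside ∷ s)) + ∑Sub n (λ s → f (inside ∷ s))

ℕ→ℚ : ℕ → ℚ
ℕ→ℚ n = + n ℚ./ 1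

record Digraph : Set where
  field
    nV       : ℕ
    adj      : Fin nV → Fin nV → Bool
    loopless : ∀ v → adj v v ≡ false
open Digraph public

arcCount : Digraph → ℕ
arcCount G = ∑ (nV G) λ x → ∑ (nV G) λ y → if adj G x y then 1 else 0

Arc : Digraph → Set
Arc G = Σ (Fin (nV G) × Fin (nV G)) λ p → adj G (proj₁ p) (proj₂ p) ≡ true

record WMultigraph : Set where
  field
    nVert  : ℕ
    nArc   : ℕ
    tail   : Fin nArc → Fin nVert
    head   : Fin nArc → Fin nVert
    noLoop : ∀ e → tail e ≢ head e
    w      : Fin nArc → ℚ
    w≥0    : ∀ e → 0ℚ ℚ.≤ w e
open WMultigraph public

IsCopy : (H : Digraph) (D : WMultigraph) → Subset (nVert D) → Subset (nArc D) → Set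
IsCopy H D U S =
  Σ (Fin (nV H) → Fin (nVert D)) λ φ →
  Σ (Arc H → Fin (nArc D)) λ ψ →
    Injective _≡_ _≡_ φ × Injective _≡_ _≡_ ψ
    × (∀ a → tail D (ψ a) ≡ φ (proj₁ (proj₁ a)) × head D (ψ a) ≡ φ (proj₂ (proj₁ a)))
    × (∀ v → (lookup U v ≡ true) ⇔ (∃[ x ] φ x ≡ v))
    × (∀ e → (lookup S e ≡ true) ⇔ (∃[ a ] ψ a ≡ e))

weightOf : (D : WMultigraph) → Subset (nArc D) → ℚ
weightOf D F = ∑ℚ (nArc D) λ e → if lookup F e then w D e else 0ℚ

Hitting : (H : Digraph) (D : WMultigraph) → Subset (nArc D) → Set
Hitting H D F = ∀ U S → IsCopy H D U S →
  ∃[ e ] (lookup S e ≡ true × lookup F e ≡ true)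

-- Fractional H-packings: functions from H-copies (identified with the
-- subgraph (U , S)) to [0,∞); value forced to 0 on non-copies.
FracPacking : (H : Digraph) (D : WMultigraph) →
  (Subset (nVert D) → Subset (nArc D) → ℚ) → Set
FracPacking H D m =
    (∀ U S → 0ℚ ℚ.≤ m U S)
  × (∀ U S → ¬ IsCopy H D U S → m U S ≡ 0ℚ)
  × (∀ e → (∑Sub (nVert D) λ U → ∑Sub (nArc D) λ S →
              if lookup S e then m U S else 0ℚ) ℚ.≤ w D e)

packingValue : (D : WMultigraph) → (Subset (nVert D) → Subset (nArc D) → ℚ) → ℚ
packingValue D m = ∑Sub (nVert D) λ U → ∑Sub (nArc D) λ S → m U S

-- Blowup B(L): vertex set Fin |V(L)| × ℕ (I_v = {v} × ℕ),
-- arc (a,i) → (b,j) iff (a,b) ∈ E(L).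

BVert : Digraph → Set
BVert L = Fin (nV L) × ℕ

BArc : (L : Digraph) → BVert L → BVert L → Set
BArc L x y = adj L (proj₁ x) (proj₁ y) ≡ true

ValidAdd : (L : Digraph) → List (BVert L × BVert L) → Set
ValidAdd L F = Unique F
  × All (λ p → proj₁ p ≢ proj₂ p × ¬ BArc L (proj₁ p) (proj₂ p)) F

ContainsCopy : (H L : Digraph) → List (BVert L × BVert L) → Set
ContainsCopy H L F =
  Σ (Fin (nV H) → BVert L) λ φ → Injective _≡_ _≡_ φ ×
    (∀ x y → adj H x y ≡ true → BArc L (φ x) (φ y) ⊎ (φ x , φ y) ∈ F)

IsDisc : (H L : Digraph) → ℕ → Set
IsDisc H L d =
    (∃[ F ] (ValidAdd L F × ContainsCopy H L F × length F ≡ d))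
  × (∀ F → ValidAdd L F → ContainsCopy H L F → d ≤ length F)

-- |E(L)| / |V(L)|^2   (the nV = 0 case never occurs for nonempty L)
density : ℕ → ℕ → ℚ
density e zero    = 0ℚ
density e (suc k) = + e ℚ./ (suc k ℕ.* suc k)

fHL : (H L : Digraph) → (d : ℕ) → ℚ
fHL H L d =
  (ℕ→ℚ (arcCount H) * (1ℚ - density (arcCount L) (nV L)))
  ⊔ (ℕ→ℚ (arcCount H) - ℕ→ℚ d)

{-# OPTIONS --safe #-}

-- Krivelevich's rounding argument. By linear programming duality there are an
-- optimal fractional packing m and an optimal fractional cover g of the same
-- value. Write h = |E(H)| and d = disc_H(L). An arc e with (h − d) g(e) ≥ 1 may
-- be put into the hitting set: it costs at most (h − d) times its contribution
-- w(e) g(e) to the cover, and we recurse with its weight set to 0. If no such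
-- arc has positive weight, map V(D) randomly to V(L) and take the arcs with
-- g > 0 that are not mapped to an arc of L. In an H-copy avoiding this set, g
-- lives on the arcs mapped to arcs of L; there are at most h − d of them, each
-- with g(e) < 1/(h − d), so the copy would not be covered by g. By complementary
-- slackness the arcs with g > 0 are saturated by m, so their total weight is at
-- most h · Σ m, and a random map misses each of them with probability
-- 1 − |E(L)|/|V(L)|².
module Submission where

open import Axiom.UniquenessOfIdentityProofs using (module Decidable⇒UIP)
open import Data.Bool using (Bool; true; false; if_then_else_; not; _∧_; _∨_)
import Data.Bool.Properties as Bool
open import Data.Fin using (Fin; zero; suc; toℕ; _↑ˡ_; _↑ʳ_; splitAt)
open import Data.Fin.Properties using (any?; all?; toℕ-injective; splitAt-↑ˡ; splitAt-↑ʳ) renaming (_≟_ to _≟ᶠ_)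
open import Data.Fin.Subset using (Subset; inside; outside)
open import Data.Integer as ℤ using () renaming (+_ to ℕ→ℤ)
import Data.Integer.Properties as ℤ
import Data.Integer.Tactic.RingSolver as ℤ-Solver
open import Data.List as List using (List; []; _∷_; _++_; map; filter; length; allFin; cartesianProduct; cartesianProductWith)
open import Data.List.Membership.Propositional using (_∈_)
open import Data.List.Membership.Propositional.Properties
open import Data.List.Properties using (length-map; length-++; filter-++; map-tabulate)
import Data.List.Relation.Unary.All as All
open import Data.List.Relation.Unary.Any using (here; there; index)
open import Data.List.Relation.Unary.Any.Properties using (lookup-index)
open import Data.List.Relation.Unary.Unique.Propositional using (Unique)
import Data.List.Relation.Unary.Unique.Propositional.Properties as Unique
open import Data.Maybe using (Maybe; just; nothing)
open import Data.Nat as ℕ using (ℕ; zero; suc; s≤s; z≤n)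
open import Data.Nat.Induction using (<-wellFounded)
import Data.Nat.Properties as ℕ
open import Data.Product using (∃; ∃-syntax; _×_; _,_; proj₁; proj₂)
open import Data.Rational
open import Data.Rational.Properties
open import Data.Rational.Unnormalised as ℚᵘ using (mkℚᵘ; *≡*)
import Data.Rational.Unnormalised.Properties as ℚᵘ
open import Data.Sum using (_⊎_; inj₁; inj₂; [_,_]′)
open import Data.Vec using (Vec; []; _∷_; lookup; tabulate)
open import Data.Vec.Properties using (≡-dec; lookup∘tabulate)
open import Defs
open import Function using (mk⇔; Equivalence; _∘_; id)
open import Function.Definitions using (Injective)
open import Induction.WellFounded using (Acc; acc)
open import Level using (0ℓ)
open import Relation.Binary.Definitions using (tri<; tri≈; tri>)
open import Relation.Binary.PropositionalEquality
open import Relation.Nullary using (¬_; Dec; does; yes; no; contradiction; ¬?)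
open import Relation.Nullary.Decidable using (dec-true; dec-false; _×-dec_; _→-dec_; map′)
open import Tactic.RingSolver using (solve-∀)
open import Tactic.RingSolver.Core.AlmostCommutativeRing using (AlmostCommutativeRing; fromCommutativeRing)

-- The factor is a maximum and not a sum because the two kinds of arcs are paid from separate parts
-- of one optimum: a heavy arc from its own term w(e) g(e), everything else from the optimum for the
-- reduced weights, which by weak duality is at most what the same g still costs. Setting a weight
-- to 0 instead of deleting the arc keeps the family of copies, and with it the notion of a cover,
-- fixed during the recursion; the number of arcs of non-zero weight decreases. The threshold is
-- kept in the form (h - d) g(e) ≥ 1, without division, so that h = d is not a special case. All
-- data are rational: the optimal pair comes as an exact witness from a theorem of the alternative,
-- and the random map becomes a finite average from which one good map is extracted.

ℚ-ring : AlmostCommutativeRing 0ℓ 0ℓ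
ℚ-ring = fromCommutativeRing +-*-commutativeRing isZero?
  where
  isZero? : ∀ p → Maybe (0ℚ ≡ p)
  isZero? p with 0ℚ ≟ p
  ... | yes eq = just eq
  ... | no _ = nothing

-- Inequalities and finite sums over ℚ

*-monoˡ : ∀ {k p q} → 0ℚ ≤ k → p ≤ q → k * p ≤ k * q
*-monoˡ {k} 0≤k = *-monoˡ-≤-nonNeg k {{nonNegative 0≤k}}

*-monoʳ : ∀ {k p q} → 0ℚ ≤ k → p ≤ q → p * k ≤ q * k
*-monoʳ {k} 0≤k = *-monoʳ-≤-nonNeg k {{nonNegative 0≤k}}

*-nonNeg : ∀ {p q} → 0ℚ ≤ p → 0ℚ ≤ q → 0ℚ ≤ p * q
*-nonNeg {p} {q} 0≤p 0≤q = subst (_≤ p * q) (*-zeroʳ p) (*-monoˡ 0≤p 0≤q)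

+-nonNeg : ∀ {p q} → 0ℚ ≤ p → 0ℚ ≤ q → 0ℚ ≤ p + q
+-nonNeg = +-mono-≤

≤⇒0≤- : ∀ {p q} → p ≤ q → 0ℚ ≤ q - p
≤⇒0≤- {p} {q} p≤q = subst (_≤ q - p) (+-inverseʳ p) (+-monoˡ-≤ (- p) p≤q)

cancel-sub : ∀ p q → (q - p) + p ≡ q
cancel-sub = solve-∀ ℚ-ring

0≤-⇒≤ : ∀ {p q} → 0ℚ ≤ q - p → p ≤ q
0≤-⇒≤ {p} {q} h = subst₂ _≤_ (+-identityˡ p) (cancel-sub p q) (+-monoˡ-≤ p h)

∑ℚ-cong : ∀ n {f g : Fin n → ℚ} → (∀ i → f i ≡ g i) → ∑ℚ n f ≡ ∑ℚ n g
∑ℚ-cong zero    eq = refl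
∑ℚ-cong (suc n) eq = cong₂ _+_ (eq zero) (∑ℚ-cong n (λ i → eq (suc i)))

∑ℚ-mono : ∀ n {f g : Fin n → ℚ} → (∀ i → f i ≤ g i) → ∑ℚ n f ≤ ∑ℚ n g
∑ℚ-mono zero    le = ≤-refl
∑ℚ-mono (suc n) le = +-mono-≤ (le zero) (∑ℚ-mono n (λ i → le (suc i)))

∑ℚ-zero : ∀ n → ∑ℚ n (λ _ → 0ℚ) ≡ 0ℚ
∑ℚ-zero zero    = refl
∑ℚ-zero (suc n) = trans (+-identityˡ _) (∑ℚ-zero n)

∑ℚ-nonNeg : ∀ n {f : Fin n → ℚ} → (∀ i → 0ℚ ≤ f i) → 0ℚ ≤ ∑ℚ n f
∑ℚ-nonNeg n {f} 0≤f = subst (_≤ ∑ℚ n f) (∑ℚ-zero n) (∑ℚ-mono n 0≤f)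

interchange : ∀ a b c d → (a + b) + (c + d) ≡ (a + c) + (b + d)
interchange = solve-∀ ℚ-ring

∑ℚ-+ : ∀ n (f g : Fin n → ℚ) → ∑ℚ n (λ i → f i + g i) ≡ ∑ℚ n f + ∑ℚ n g
∑ℚ-+ zero    f g = refl
∑ℚ-+ (suc n) f g = trans (cong (f zero + g zero +_) (∑ℚ-+ n _ _)) (interchange (f zero) (g zero) _ _)

∑ℚ-*ˡ : ∀ n k (f : Fin n → ℚ) → ∑ℚ n (λ i → k * f i) ≡ k * ∑ℚ n f
∑ℚ-*ˡ zero    k f = sym (*-zeroʳ k)
∑ℚ-*ˡ (suc n) k f = trans (cong (k * f zero +_) (∑ℚ-*ˡ n k _)) (sym (*-distribˡ-+ k (f zero) _))

∑ℚ-*ʳ : ∀ n k (f : Fin n → ℚ) → ∑ℚ n (λ i → f i * k) ≡ ∑ℚ n f * k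
∑ℚ-*ʳ n k f = trans (∑ℚ-cong n λ i → *-comm (f i) k) (trans (∑ℚ-*ˡ n k f) (*-comm k _))

∑ℚ-swap : ∀ m n (f : Fin m → Fin n → ℚ) →
  ∑ℚ m (λ i → ∑ℚ n (f i)) ≡ ∑ℚ n (λ j → ∑ℚ m (λ i → f i j))
∑ℚ-swap zero    n f = sym (∑ℚ-zero n)
∑ℚ-swap (suc m) n f = trans (cong (∑ℚ n (f zero) +_) (∑ℚ-swap m n _)) (sym (∑ℚ-+ n (f zero) _))

∑ℚ-++ : ∀ m n (f : Fin (m ℕ.+ n) → ℚ) →
  ∑ℚ (m ℕ.+ n) f ≡ ∑ℚ m (λ i → f (i ↑ˡ n)) + ∑ℚ n (λ j → f (m ↑ʳ j))
∑ℚ-++ zero    n f = sym (+-identityˡ _)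
∑ℚ-++ (suc m) n f = trans (cong (f zero +_) (∑ℚ-++ m n _)) (sym (+-assoc (f zero) _ _))

term≤∑ℚ : ∀ n {f : Fin n → ℚ} → (∀ i → 0ℚ ≤ f i) → ∀ i → f i ≤ ∑ℚ n f
term≤∑ℚ (suc n) {f} 0≤f zero    =
  subst (_≤ ∑ℚ (suc n) f) (+-identityʳ _) (+-monoʳ-≤ (f zero) (∑ℚ-nonNeg n (λ i → 0≤f (suc i))))
term≤∑ℚ (suc n) {f} 0≤f (suc i) =
  subst (_≤ ∑ℚ (suc n) f) (+-identityˡ _) (+-mono-≤ (0≤f zero) (term≤∑ℚ n (λ i → 0≤f (suc i)) i))

-- Farkas' lemma by Fourier–Motzkin elimination

record Row (n : ℕ) : Set where
  constructor row
  field
    coeff : Fin n → ℚ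
    rhs   : ℚ
open Row

Satisfies : ∀ {n} → (Fin n → ℚ) → Row n → Set
Satisfies {n} x r = ∑ℚ n (λ i → coeff r i * x i) ≤ rhs r

_⊕_ : ∀ {n} → Row n → Row n → Row n
r ⊕ s = row (λ i → coeff r i + coeff s i) (rhs r + rhs s)

_⊙_ : ∀ {n} → ℚ → Row n → Row n
k ⊙ r = row (λ i → k * coeff r i) (k * rhs r)

-- Derivations are used instead of coefficient vectors because after an elimination the generators
-- are themselves derived rows; a derivation over them then unfolds into one over the original
-- generators.
data Cone {n} {C : Set} (gens : C → Row n) : Row n → Set where
  gen   : ∀ c → Cone gens (gens c)
  add   : ∀ {r s} → Cone gens r → Cone gens s → Cone gens (r ⊕ s)
  scale : ∀ {k r} → 0ℚ ≤ k → Cone gens r → Cone gens (k ⊙ r)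

cons : ∀ {n} → ℚ → (Fin n → ℚ) → Fin (suc n) → ℚ
cons a x zero    = a
cons a x (suc i) = x i

dropHead : ∀ {n} → Row (suc n) → Row n
dropHead r = row (λ i → coeff r (suc i)) (rhs r)

dropHead-⊕ : ∀ {n} (r s : Row (suc n)) {r′ s′} →
  dropHead r ≡ r′ → dropHead s ≡ s′ → dropHead (r ⊕ s) ≡ r′ ⊕ s′
dropHead-⊕ _ _ refl refl = refl

dropHead-⊙ : ∀ {n} k (r : Row (suc n)) {r′} → dropHead r ≡ r′ → dropHead (k ⊙ r) ≡ k ⊙ r′
dropHead-⊙ k _ refl = refl

lowerBound : ∀ {B : Set} (g : B → ℚ) (bs : List B) → ∃[ x ] (∀ {b} → b ∈ bs → x ≤ g b)
lowerBound g []       = 0ℚ , λ ()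
lowerBound g (b ∷ bs) with lowerBound g bs
... | x , below = g b ⊓ x , λ where
  (here refl) → p⊓q≤p (g b) x
  (there b∈)  → ≤-trans (p⊓q≤q (g b) x) (below b∈)

-- The maximum of all `f a` works. It is started from a value below every `g b`, so that the case of
-- no lower bounds is included.
between : ∀ {A B : Set} (f : A → ℚ) (g : B → ℚ) (as : List A) (bs : List B) →
  (∀ {a b} → a ∈ as → b ∈ bs → f a ≤ g b) →
  ∃[ x ] ((∀ {a} → a ∈ as → f a ≤ x) × (∀ {b} → b ∈ bs → x ≤ g b))
between f g []       bs le with lowerBound g bs
... | x , below = x , (λ ()) , below
between f g (a ∷ as) bs le with between f g as bs (λ a∈ → le (there a∈))
... | x , above , below =
  f a ⊔ x ,
  (λ where
    (here refl) → p≤p⊔q (f a) x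
    (there a∈)  → ≤-trans (above a∈) (p≤q⊔p (f a) x)) ,
  λ b∈ → ⊔-lub (le (here refl) b∈) (below b∈)

WithHead : ∀ {n} {C : Set} → (C → Row (suc n)) → ℚ → Set
WithHead gens v = ∃[ r ] (Cone gens r × coeff r zero ≡ v)

scale-sat : ∀ {n} {k} (x : Fin n → ℚ) (r : Row n) → 0ℚ < k → Satisfies x (k ⊙ r) → Satisfies x r
scale-sat {n} {k} x r 0<k s = *-cancelˡ-≤-pos k {{positive 0<k}} (subst (_≤ k * rhs r) eq s)
  where
  eq : ∑ℚ n (λ i → (k * coeff r i) * x i) ≡ k * ∑ℚ n (λ i → coeff r i * x i)
  eq = trans (∑ℚ-cong n λ i → *-assoc k (coeff r i) (x i)) (∑ℚ-*ˡ n k _)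

-- The factor is positive, so scaling preserves the direction of an inequality; with heads 1 and -1,
-- an upper and a lower bound on the first variable cancel by plain addition.
normalise : ∀ p → p ≡ 0ℚ ⊎ ∃[ k ] (0ℚ < k × (k * p ≡ 1ℚ ⊎ k * p ≡ - 1ℚ))
normalise p with <-cmp p 0ℚ
... | tri≈ _ p≡0 _ = inj₁ p≡0
... | tri> _ _ 0<p = inj₂ (1/ p , positive⁻¹ _ {{1/pos⇒pos p}} , inj₁ (*-inverseˡ p))
  where instance
    p⁺ = positive 0<p
    p≢0 = pos⇒nonZero p
... | tri< p<0 _ _ = inj₂ (- (1/ p) , neg-antimono-< (negative⁻¹ _ {{1/neg⇒neg p}}) ,
    inj₂ (trans (sym (neg-distribˡ-* (1/ p) p)) (cong -_ (*-inverseˡ p))))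
  where instance
    p⁻ = negative p<0
    p≢0 = neg⇒nonZero p

SatisfiesAll : ∀ {n v} {C : Set} {gens : C → Row (suc n)} → (Fin (suc n) → ℚ) → List (WithHead gens v) → Set
SatisfiesAll x rs = ∀ {r} → r ∈ rs → Satisfies x (proj₁ r)

-- `complete` records only the passage from the normalised rows back to the generators; the other
-- direction is carried by the derivations stored in `WithHead`.
record Split {n} {C : Set} (gens : C → Row (suc n)) (cs : List C) : Set where
  constructor parts
  field
    zs : List (WithHead gens 0ℚ)
    us : List (WithHead gens 1ℚ)
    ls : List (WithHead gens (- 1ℚ))
    complete : ∀ x → SatisfiesAll x zs → SatisfiesAll x us → SatisfiesAll x ls →
      ∀ {c} → c ∈ cs → Satisfies x (gens c)

split : ∀ {n} {C : Set} (gens : C → Row (suc n)) cs → Split gens cs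
split gens [] = parts [] [] [] (λ _ _ _ _ ())
split gens (c ∷ cs) with split gens cs | normalise (coeff (gens c) zero)
... | parts zs us ls complete | inj₁ eq = parts ((gens c , gen c , eq) ∷ zs) us ls λ where
  x sz su sl (here refl) → sz (here refl)
  x sz su sl (there c∈)  → complete x (λ z∈ → sz (there z∈)) su sl c∈
... | parts zs us ls complete | inj₂ (k , 0<k , inj₁ eq) =
  parts zs ((k ⊙ gens c , scale (<⇒≤ 0<k) (gen c) , eq) ∷ us) ls λ where
    x sz su sl (here refl) → scale-sat x (gens c) 0<k (su (here refl))
    x sz su sl (there c∈)  → complete x sz (λ u∈ → su (there u∈)) sl c∈
... | parts zs us ls complete | inj₂ (k , 0<k , inj₂ eq) =
  parts zs us ((k ⊙ gens c , scale (<⇒≤ 0<k) (gen c) , eq) ∷ ls) λ where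
    x sz su sl (here refl) → scale-sat x (gens c) 0<k (sl (here refl))
    x sz su sl (there c∈)  → complete x sz su (λ l∈ → sl (there l∈)) c∈

-- The same derivation is replayed on the full rows. Sums and multiples keep a zero head
-- coefficient, so a certificate found after the elimination is also one before it.
lift-cone : ∀ {n} {C : Set} {gens : C → Row (suc n)} {r} →
  Cone {C = WithHead gens 0ℚ} (λ z → dropHead (proj₁ z)) r →
  ∃[ r̂ ] (Cone gens r̂ × coeff r̂ zero ≡ 0ℚ × dropHead r̂ ≡ r)
lift-cone (gen (r , r∈ , eq)) = r , r∈ , eq , refl
lift-cone (add a b) with lift-cone a | lift-cone b
... | r , r∈ , r0 , req | s , s∈ , s0 , seq =
  r ⊕ s , add r∈ s∈ , cong₂ _+_ r0 s0 , dropHead-⊕ r s req seq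
lift-cone (scale {k} 0≤k a) with lift-cone a
... | r , r∈ , r0 , req =
  k ⊙ r , scale 0≤k r∈ , trans (cong (k *_) r0) (*-zeroʳ k) , dropHead-⊙ k r req

-- Adding every upper bound on the first variable to every lower bound eliminates it. A solution of
-- the reduced system extends by a value between the bounds, and a contradiction lifts by
-- `lift-cone`. The index type `C` changes in the recursive call, since the new generators are rows
-- together with their derivations.
farkas : ∀ n {C : Set} (gens : C → Row n) (cs : List C) →
  (∃[ x ] (∀ {c} → c ∈ cs → Satisfies x (gens c))) ⊎
  (∃[ r ] (Cone gens r × (∀ i → coeff r i ≡ 0ℚ) × rhs r < 0ℚ))
farkas zero gens [] = inj₁ ((λ ()) , λ ())
farkas zero gens (c ∷ cs) with farkas zero gens cs | 0ℚ ≤? rhs (gens c)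
... | inj₂ cert    | _        = inj₂ cert
... | inj₁ _       | no  0≰b  = inj₂ (gens c , gen c , (λ ()) , ≰⇒> 0≰b)
... | inj₁ (x , s) | yes 0≤b  = inj₁ (x , λ { (here refl) → 0≤b ; (there c∈) → s c∈ })
farkas (suc n) {C} gens cs with
  (let open Split (split gens cs) in
   farkas n {WithHead gens 0ℚ} (λ z → dropHead (proj₁ z)) (zs ++ cartesianProductWith eliminate us ls))
  where
  eliminate : WithHead gens 1ℚ → WithHead gens (- 1ℚ) → WithHead gens 0ℚ
  eliminate (r , r∈ , r1) (s , s∈ , s-1) = r ⊕ s , add r∈ s∈ , trans (cong₂ _+_ r1 s-1) (+-inverseʳ 1ℚ)
... | inj₂ (r , r∈ , r≡0 , r<0) with lift-cone r∈
...   | r̂ , r̂∈ , r̂0 , refl = inj₂ (r̂ , r̂∈ , (λ { zero → r̂0 ; (suc i) → r≡0 i }) , r<0)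
farkas (suc n) {C} gens cs | inj₁ (x , sat) = inj₁ (cons t x , complete (cons t x) satZ satU satL)
  where
  open Split (split gens cs)
  dot : Row (suc n) → ℚ
  dot r = ∑ℚ n (λ i → coeff r (suc i) * x i)
  hi : WithHead gens 1ℚ → ℚ
  hi (r , _) = rhs r - dot r
  lo : WithHead gens (- 1ℚ) → ℚ
  lo (r , _) = dot r - rhs r
  rearrange : ∀ a b c d → (b + d) - (a + c) ≡ (b - a) - (c - d)
  rearrange = solve-∀ ℚ-ring
  -- The sum of the two rows belongs to the reduced system, and its inequality at `x` is this one
  -- rearranged.
  lo≤hi : ∀ {l u} → l ∈ ls → u ∈ us → lo l ≤ hi u
  lo≤hi {s , _} {r , _} l∈ u∈ = 0≤-⇒≤ (subst (0ℚ ≤_) (rearrange (dot r) (rhs r) (dot s) (rhs s))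
    (≤⇒0≤- (subst (_≤ rhs r + rhs s)
      (trans (∑ℚ-cong n λ i → *-distribʳ-+ (x i) (coeff r (suc i)) (coeff s (suc i))) (∑ℚ-+ n _ _))
      (sat (∈-++⁺ʳ zs (∈-cartesianProductWith⁺ _ u∈ l∈))))))
  bounds = between lo hi ls us lo≤hi
  t = proj₁ bounds
  satZ : ∀ {z} → z ∈ zs → Satisfies (cons t x) (proj₁ z)
  satZ {r , _ , r0} z∈ = subst (_≤ rhs r)
    (sym (trans (cong (λ h → h * t + dot r) r0) (trans (cong (_+ dot r) (*-zeroˡ t)) (+-identityˡ _))))
    (sat (∈-++⁺ˡ z∈))
  satU : ∀ {u} → u ∈ us → Satisfies (cons t x) (proj₁ u)
  satU {r , _ , r1} u∈ = subst₂ _≤_ (cong (λ h → h * t + dot r) (sym r1)) refl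
    (subst (_≤ rhs r) (cong (_+ dot r) (sym (*-identityˡ t)))
     (subst (t + dot r ≤_) (cancel-sub (dot r) (rhs r)) (+-monoˡ-≤ (dot r) (proj₂ (proj₂ bounds) u∈))))
  shuffle₁ : ∀ a b t → (a - b) + (- t + b) ≡ - t + a
  shuffle₁ = solve-∀ ℚ-ring
  shuffle₂ : ∀ b t → t + (- t + b) ≡ b
  shuffle₂ = solve-∀ ℚ-ring
  satL : ∀ {l} → l ∈ ls → Satisfies (cons t x) (proj₁ l)
  satL {r , _ , r-1} l∈ = subst (_≤ rhs r)
    (cong (_+ dot r) (trans (trans (cong -_ (sym (*-identityˡ t))) (neg-distribˡ-* 1ℚ t)) (cong (_* t) (sym r-1))))
    (subst₂ _≤_ (shuffle₁ (dot r) (rhs r) t) (shuffle₂ (rhs r) t)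
      (+-monoˡ-≤ (- t + rhs r) (proj₁ (proj₂ bounds) l∈)))

-- Indicators and bilinear sums

ι : Bool → ℚ
ι b = if b then 1ℚ else 0ℚ

0≤ι : ∀ b → 0ℚ ≤ ι b
0≤ι true  = nonNegative⁻¹ 1ℚ
0≤ι false = ≤-refl

δ : ∀ {n} → Fin n → Fin n → ℚ
δ i j = ι (does (i ≟ᶠ j))

∑ℚ-0* : ∀ n (f : Fin n → ℚ) → ∑ℚ n (λ i → 0ℚ * f i) ≡ 0ℚ
∑ℚ-0* n f = trans (∑ℚ-cong n λ i → *-zeroˡ (f i)) (∑ℚ-zero n)

∑ℚ-δ : ∀ {n} (i : Fin n) (f : Fin n → ℚ) → ∑ℚ n (λ j → δ i j * f j) ≡ f i
∑ℚ-δ {suc n} zero    f = trans (cong₂ _+_ (*-identityˡ (f zero)) (∑ℚ-0* n (λ j → f (suc j)))) (+-identityʳ (f zero))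
∑ℚ-δ {suc n} (suc i) f = trans (cong₂ _+_ (*-zeroˡ (f zero)) (∑ℚ-δ i (λ j → f (suc j)))) (+-identityˡ _)

∑ℚ-+* : ∀ n (y y′ f : Fin n → ℚ) →
  ∑ℚ n (λ i → (y i + y′ i) * f i) ≡ ∑ℚ n (λ i → y i * f i) + ∑ℚ n (λ i → y′ i * f i)
∑ℚ-+* n y y′ f = trans (∑ℚ-cong n λ i → *-distribʳ-+ (f i) (y i) (y′ i)) (∑ℚ-+ n _ _)

∑ℚ-** : ∀ n k (y f : Fin n → ℚ) → ∑ℚ n (λ i → (k * y i) * f i) ≡ k * ∑ℚ n (λ i → y i * f i)
∑ℚ-** n k y f = trans (∑ℚ-cong n λ i → *-assoc k (y i) (f i)) (∑ℚ-*ˡ n k _)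

-- Transposition of the matrix `a`: the exchange of summation behind every duality argument below.
∑ℚ-bilinear : ∀ M N (a : Fin M → Fin N → ℚ) (x : Fin M → ℚ) (y : Fin N → ℚ) →
  ∑ℚ M (λ i → x i * ∑ℚ N (λ j → a i j * y j)) ≡ ∑ℚ N (λ j → y j * ∑ℚ M (λ i → a i j * x i))
∑ℚ-bilinear M N a x y = begin
  ∑ℚ M (λ i → x i * ∑ℚ N (λ j → a i j * y j))   ≡⟨ ∑ℚ-cong M (λ i → sym (∑ℚ-*ˡ N (x i) _)) ⟩
  ∑ℚ M (λ i → ∑ℚ N (λ j → x i * (a i j * y j))) ≡⟨ ∑ℚ-swap M N _ ⟩
  ∑ℚ N (λ j → ∑ℚ M (λ i → x i * (a i j * y j))) ≡⟨ ∑ℚ-cong N (λ j → ∑ℚ-cong M (λ i → comm (x i) (a i j) (y j))) ⟩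
  ∑ℚ N (λ j → ∑ℚ M (λ i → y j * (a i j * x i))) ≡⟨ ∑ℚ-cong N (λ j → ∑ℚ-*ˡ M (y j) _) ⟩
  ∑ℚ N (λ j → y j * ∑ℚ M (λ i → a i j * x i))   ∎
  where
  open ≡-Reasoning
  comm : ∀ a b c → a * (b * c) ≡ c * (b * a)
  comm = solve-∀ ℚ-ring

-- Linear programming duality for packing and covering

module _ (N E : ℕ) (A : Fin N → Fin E → ℚ) (w : Fin E → ℚ) where

  Packing : (Fin N → ℚ) → Set
  Packing m = (∀ i → 0ℚ ≤ m i) × (∀ e → ∑ℚ N (λ i → A i e * m i) ≤ w e)

  Cover : (Fin E → ℚ) → Set
  Cover g = (∀ e → 0ℚ ≤ g e) × (∀ i → 1ℚ ≤ ∑ℚ E (λ e → A i e * g e))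

  weak-duality : ∀ {m g} → Packing m → Cover g → ∑ℚ N m ≤ ∑ℚ E (λ e → g e * w e)
  weak-duality {m} {g} (0≤m , pack) (0≤g , cover) = begin
    ∑ℚ N m                                        ≡⟨ ∑ℚ-cong N (λ i → sym (*-identityʳ (m i))) ⟩
    ∑ℚ N (λ i → m i * 1ℚ)                         ≤⟨ ∑ℚ-mono N (λ i → *-monoˡ (0≤m i) (cover i)) ⟩
    ∑ℚ N (λ i → m i * ∑ℚ E (λ e → A i e * g e))   ≡⟨ ∑ℚ-bilinear N E A m g ⟩
    ∑ℚ E (λ e → g e * ∑ℚ N (λ i → A i e * m i))   ≤⟨ ∑ℚ-mono E (λ e → *-monoˡ (0≤g e) (pack e)) ⟩
    ∑ℚ E (λ e → g e * w e)                        ∎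
    where open ≤-Reasoning

  -- The gaps `g e * (w e - s e)` are non-negative, and optimality makes their sum at most 0, so
  -- each of them vanishes; where `g e` is positive it can be cancelled.
  slackness : ∀ {m g} → Packing m → Cover g → ∑ℚ E (λ e → g e * w e) ≤ ∑ℚ N m →
    ∀ e → 0ℚ < g e → w e ≤ ∑ℚ N (λ i → A i e * m i)
  slackness {m} {g} (0≤m , pack) (0≤g , cover) opt e 0<g =
    *-cancelˡ-≤-pos (g e) {{positive 0<g}} (0≤-⇒≤ (≤-trans gap≥ (≤-reflexive (sym (gap-split e)))))
    where
    s : Fin E → ℚ
    s e = ∑ℚ N (λ i → A i e * m i)
    gap : Fin E → ℚ
    gap e = g e * (w e - s e)
    0≤gap : ∀ e → 0ℚ ≤ gap e
    0≤gap e = *-nonNeg (0≤g e) (≤⇒0≤- (pack e))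
    gap-split : ∀ e → g e * s e - g e * w e ≡ - gap e
    gap-split e = lemma (g e) (w e) (s e)
      where
      lemma : ∀ g w s → g * s - g * w ≡ - (g * (w - s))
      lemma = solve-∀ ℚ-ring
    shuffle : ∀ g w s → g * w ≡ g * (w - s) + g * s
    shuffle = solve-∀ ℚ-ring
    ∑gap : ∑ℚ E (λ e → g e * w e) ≡ ∑ℚ E gap + ∑ℚ E (λ e → g e * s e)
    ∑gap = trans (∑ℚ-cong E λ e → shuffle (g e) (w e) (s e)) (∑ℚ-+ E _ _)
    m≤gs : ∑ℚ N m ≤ ∑ℚ E (λ e → g e * s e)
    m≤gs = subst₂ _≤_ (∑ℚ-cong N λ i → *-identityʳ (m i)) (∑ℚ-bilinear N E A m g)
      (∑ℚ-mono N λ i → *-monoˡ (0≤m i) (cover i))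
    ∑gap≤0 : ∑ℚ E gap ≤ 0ℚ
    ∑gap≤0 = subst₂ _≤_ (cancel (∑ℚ E gap) _) (+-inverseʳ (∑ℚ E (λ e → g e * s e)))
      (+-monoˡ-≤ (- ∑ℚ E (λ e → g e * s e)) (≤-trans (≤-reflexive (sym ∑gap)) (≤-trans opt m≤gs)))
      where
      cancel : ∀ a b → (a + b) - b ≡ a
      cancel = solve-∀ ℚ-ring
    gap≥ : 0ℚ ≤ - gap e
    gap≥ = neg-antimono-≤ (≤-trans (term≤∑ℚ E 0≤gap e) ∑gap≤0)

  private
    -- Primal and dual feasibility form one system in the variables `m` and `g`, and `opt` asks that
    -- the cost of `g` not exceed the value of `m`. A solution is then an optimal pair, so nothing
    -- has to be optimised: only infeasibility has to be refuted.
    data Constraint : Set where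
      m≥0   : Fin N → Constraint
      g≥0   : Fin E → Constraint
      pack  : Fin E → Constraint
      cover : Fin N → Constraint
      opt   : Constraint

    constraints : List Constraint
    constraints = opt ∷ map m≥0 (allFin N) ++ map g≥0 (allFin E) ++ map pack (allFin E) ++ map cover (allFin N)

    all-listed : ∀ c → c ∈ constraints
    all-listed opt       = here refl
    all-listed (m≥0 i)   = there (∈-++⁺ˡ (∈-map⁺ m≥0 (∈-allFin i)))
    all-listed (g≥0 e)   = there (∈-++⁺ʳ (map m≥0 (allFin N)) (∈-++⁺ˡ (∈-map⁺ g≥0 (∈-allFin e))))
    all-listed (pack e)  = there (∈-++⁺ʳ (map m≥0 (allFin N)) (∈-++⁺ʳ (map g≥0 (allFin E))
      (∈-++⁺ˡ (∈-map⁺ pack (∈-allFin e)))))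
    all-listed (cover i) = there (∈-++⁺ʳ (map m≥0 (allFin N)) (∈-++⁺ʳ (map g≥0 (allFin E))
      (∈-++⁺ʳ (map pack (allFin E)) (∈-map⁺ cover (∈-allFin i)))))

    block : (Fin N → ℚ) → (Fin E → ℚ) → Fin (N ℕ.+ E) → ℚ
    block α β j = [ α , β ]′ (splitAt N j)

    blockˡ : ∀ α β i → block α β (i ↑ˡ E) ≡ α i
    blockˡ α β i = cong [ α , β ]′ (splitAt-↑ˡ N i E)

    blockʳ : ∀ α β e → block α β (N ↑ʳ e) ≡ β e
    blockʳ α β e = cong [ α , β ]′ (splitAt-↑ʳ N E e)

    gens : Constraint → Row (N ℕ.+ E)
    gens (m≥0 i)   = row (block (λ i′ → - δ i i′) (λ _ → 0ℚ)) 0ℚ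
    gens (g≥0 e)   = row (block (λ _ → 0ℚ) (λ e′ → - δ e e′)) 0ℚ
    gens (pack e)  = row (block (λ i → A i e) (λ _ → 0ℚ)) (w e)
    gens (cover i) = row (block (λ _ → 0ℚ) (λ e → - A i e)) (- 1ℚ)
    gens opt       = row (block (λ _ → - 1ℚ) w) 0ℚ

    block-dot : ∀ α β (x : Fin (N ℕ.+ E) → ℚ) → ∑ℚ (N ℕ.+ E) (λ j → block α β j * x j) ≡
      ∑ℚ N (λ i → α i * x (i ↑ˡ E)) + ∑ℚ E (λ e → β e * x (N ↑ʳ e))
    block-dot α β x = trans (∑ℚ-++ N E _) (cong₂ _+_
      (∑ℚ-cong N λ i → cong (_* x (i ↑ˡ E)) (blockˡ α β i))
      (∑ℚ-cong E λ e → cong (_* x (N ↑ʳ e)) (blockʳ α β e)))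

    -- y, z, t are the multipliers of pack, cover, opt; those of the sign
    -- constraints are absorbed into the inequalities onM and onG.
    record Multipliers (r : Row (N ℕ.+ E)) : Set where
      field
        y   : Fin E → ℚ
        z   : Fin N → ℚ
        t   : ℚ
        0≤y : ∀ e → 0ℚ ≤ y e
        0≤z : ∀ i → 0ℚ ≤ z i
        0≤t : 0ℚ ≤ t
        onM : ∀ i → coeff r (i ↑ˡ E) ≤ ∑ℚ E (λ e → y e * A i e) - t
        onG : ∀ e → coeff r (N ↑ʳ e) ≤ t * w e - ∑ℚ N (λ i → z i * A i e)
        onR : rhs r ≡ ∑ℚ E (λ e → y e * w e) - ∑ℚ N z

    open Multipliers

    add-sub : ∀ a b c d → (a - b) + (c - d) ≡ (a + c) - (b + d)
    add-sub = solve-∀ ℚ-ring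

    scale-sub : ∀ k a b → k * (a - b) ≡ k * a - k * b
    scale-sub = solve-∀ ℚ-ring

    multipliers : ∀ {r} → Cone gens r → Multipliers r
    multipliers (gen (m≥0 i)) = record
      { y = λ _ → 0ℚ ; z = λ _ → 0ℚ ; t = 0ℚ
      ; 0≤y = λ _ → ≤-refl ; 0≤z = λ _ → ≤-refl ; 0≤t = ≤-refl
      ; onM = λ i′ → subst₂ _≤_ (sym (blockˡ _ _ i′)) (sym (cong (_- 0ℚ) (∑ℚ-0* E (A i′)))) (neg-antimono-≤ (0≤ι _))
      ; onG = λ e → ≤-reflexive (trans (blockʳ _ _ e) (sym (cong₂ _-_ (*-zeroˡ (w e)) (∑ℚ-0* N (λ i → A i e)))))
      ; onR = sym (cong₂ _-_ (∑ℚ-0* E w) (∑ℚ-zero N)) }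
    multipliers (gen (g≥0 e)) = record
      { y = λ _ → 0ℚ ; z = λ _ → 0ℚ ; t = 0ℚ
      ; 0≤y = λ _ → ≤-refl ; 0≤z = λ _ → ≤-refl ; 0≤t = ≤-refl
      ; onM = λ i → ≤-reflexive (trans (blockˡ _ _ i) (sym (cong (_- 0ℚ) (∑ℚ-0* E (A i)))))
      ; onG = λ e′ → subst₂ _≤_ (sym (blockʳ _ _ e′)) (sym (cong₂ _-_ (*-zeroˡ (w e′)) (∑ℚ-0* N (λ i → A i e′)))) (neg-antimono-≤ (0≤ι _))
      ; onR = sym (cong₂ _-_ (∑ℚ-0* E w) (∑ℚ-zero N)) }
    multipliers (gen (pack e)) = record
      { y = δ e ; z = λ _ → 0ℚ ; t = 0ℚ
      ; 0≤y = λ _ → 0≤ι _ ; 0≤z = λ _ → ≤-refl ; 0≤t = ≤-refl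
      ; onM = λ i → ≤-reflexive (trans (blockˡ _ _ i) (sym (trans (+-identityʳ _) (∑ℚ-δ e (A i)))))
      ; onG = λ e′ → ≤-reflexive (trans (blockʳ _ _ e′) (sym (cong₂ _-_ (*-zeroˡ (w e′)) (∑ℚ-0* N (λ i → A i e′)))))
      ; onR = sym (trans (cong₂ _-_ (∑ℚ-δ e w) (∑ℚ-zero N)) (+-identityʳ (w e))) }
    multipliers (gen (cover i)) = record
      { y = λ _ → 0ℚ ; z = δ i ; t = 0ℚ
      ; 0≤y = λ _ → ≤-refl ; 0≤z = λ _ → 0≤ι _ ; 0≤t = ≤-refl
      ; onM = λ i → ≤-reflexive (trans (blockˡ _ _ i) (sym (cong (_- 0ℚ) (∑ℚ-0* E (A i)))))
      ; onG = λ e → ≤-reflexive (trans (blockʳ _ _ e)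
          (sym (trans (cong₂ _-_ (*-zeroˡ (w e)) (∑ℚ-δ i (λ i′ → A i′ e))) (+-identityˡ _))))
      ; onR = sym (cong₂ _-_ (∑ℚ-0* E w)
          (trans (∑ℚ-cong N λ i′ → sym (*-identityʳ (δ i i′))) (∑ℚ-δ i (λ _ → 1ℚ)))) }
    multipliers (gen opt) = record
      { y = λ _ → 0ℚ ; z = λ _ → 0ℚ ; t = 1ℚ
      ; 0≤y = λ _ → ≤-refl ; 0≤z = λ _ → ≤-refl ; 0≤t = nonNegative⁻¹ 1ℚ
      ; onM = λ i → ≤-reflexive (trans (blockˡ _ _ i) (sym (cong (_- 1ℚ) (∑ℚ-0* E (A i)))))
      ; onG = λ e → ≤-reflexive (trans (blockʳ _ _ e)
          (sym (trans (cong₂ _-_ (*-identityˡ (w e)) (∑ℚ-0* N (λ i → A i e))) (+-identityʳ _))))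
      ; onR = sym (cong₂ _-_ (∑ℚ-0* E w) (∑ℚ-zero N)) }
    multipliers (add {r} {s} r∈ s∈) with multipliers r∈ | multipliers s∈
    ... | a | b = record
      { y = λ e → y a e + y b e ; z = λ i → z a i + z b i ; t = t a + t b
      ; 0≤y = λ e → +-nonNeg (0≤y a e) (0≤y b e)
      ; 0≤z = λ i → +-nonNeg (0≤z a i) (0≤z b i)
      ; 0≤t = +-nonNeg (0≤t a) (0≤t b)
      ; onM = λ i → ≤-trans (+-mono-≤ (onM a i) (onM b i)) (≤-reflexive
          (trans (add-sub (∑ℚ E _) (t a) (∑ℚ E _) (t b)) (cong (_- (t a + t b)) (sym (∑ℚ-+* E (y a) (y b) _)))))
      ; onG = λ e → ≤-trans (+-mono-≤ (onG a e) (onG b e)) (≤-reflexive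
          (trans (add-sub (t a * w e) (∑ℚ N _) (t b * w e) (∑ℚ N _))
            (cong₂ _-_ (sym (*-distribʳ-+ (w e) (t a) (t b))) (sym (∑ℚ-+* N (z a) (z b) _)))))
      ; onR = trans (cong₂ _+_ (onR a) (onR b)) (trans (add-sub (∑ℚ E _) (∑ℚ N _) (∑ℚ E _) (∑ℚ N _))
          (cong₂ _-_ (sym (∑ℚ-+* E (y a) (y b) w)) (sym (∑ℚ-+ N (z a) (z b))))) }
    multipliers (scale {k} {r} 0≤k r∈) with multipliers r∈
    ... | a = record
      { y = λ e → k * y a e ; z = λ i → k * z a i ; t = k * t a
      ; 0≤y = λ e → *-nonNeg 0≤k (0≤y a e)
      ; 0≤z = λ i → *-nonNeg 0≤k (0≤z a i)
      ; 0≤t = *-nonNeg 0≤k (0≤t a)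
      ; onM = λ i → ≤-trans (*-monoˡ 0≤k (onM a i)) (≤-reflexive
          (trans (scale-sub k (∑ℚ E _) (t a)) (cong (_- (k * t a)) (sym (∑ℚ-** E k (y a) _)))))
      ; onG = λ e → ≤-trans (*-monoˡ 0≤k (onG a e)) (≤-reflexive
          (trans (scale-sub k (t a * w e) (∑ℚ N _))
            (cong₂ _-_ (sym (*-assoc k (t a) (w e))) (sym (∑ℚ-** N k (z a) _)))))
      ; onR = trans (cong (k *_) (onR a)) (trans (scale-sub k (∑ℚ E _) (∑ℚ N _))
          (cong₂ _-_ (sym (∑ℚ-** E k (y a) w)) (sym (∑ℚ-*ˡ N k (z a))))) }

    -- A certificate says that `y` covers every copy to the extent `t` and that `z` packs into `t`
    -- times the weights, although `yw < z̄`. Chaining as in weak duality gives `t * z̄ ≤ t * yw`,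
    -- which is absurd for positive `t`; the degenerate case `t = 0` is `z̄≤0`.
    module Infeasible (0≤w : ∀ e → 0ℚ ≤ w e) (1≤A : ∀ i → 1ℚ ≤ ∑ℚ E (A i))
      {r} (M : Multipliers r) (r≡0 : ∀ j → coeff r j ≡ 0ℚ) (r<0 : rhs r < 0ℚ) where

      yw z̄ : ℚ
      yw = ∑ℚ E (λ e → y M e * w e)
      z̄ = ∑ℚ N (z M)

      yw<z̄ : yw < z̄
      yw<z̄ = subst₂ _<_ (cancel-sub z̄ yw) (+-identityˡ z̄) (+-monoˡ-< z̄ (subst (_< 0ℚ) (onR M) r<0))

      t≤yA : ∀ i → t M ≤ ∑ℚ E (λ e → A i e * y M e)
      t≤yA i = subst (t M ≤_) (∑ℚ-cong E λ e → *-comm (y M e) (A i e)) (0≤-⇒≤ (subst (_≤ _) (r≡0 _) (onM M i)))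

      Az≤tw : ∀ e → ∑ℚ N (λ i → A i e * z M i) ≤ t M * w e
      Az≤tw e = subst (_≤ t M * w e) (∑ℚ-cong N λ i → *-comm (z M i) (A i e)) (0≤-⇒≤ (subst (_≤ _) (r≡0 _) (onG M e)))

      tz̄≤tyw : t M * z̄ ≤ t M * yw
      tz̄≤tyw = begin
        t M * z̄                                              ≡⟨ trans (*-comm (t M) z̄) (sym (∑ℚ-*ʳ N (t M) (z M))) ⟩
        ∑ℚ N (λ i → z M i * t M)                             ≤⟨ ∑ℚ-mono N (λ i → *-monoˡ (0≤z M i) (t≤yA i)) ⟩
        ∑ℚ N (λ i → z M i * ∑ℚ E (λ e → A i e * y M e))      ≡⟨ ∑ℚ-bilinear N E A (z M) (y M) ⟩
        ∑ℚ E (λ e → y M e * ∑ℚ N (λ i → A i e * z M i))      ≤⟨ ∑ℚ-mono E (λ e → *-monoˡ (0≤y M e) (Az≤tw e)) ⟩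
        ∑ℚ E (λ e → y M e * (t M * w e))                     ≡⟨ ∑ℚ-cong E (λ e → comm (y M e) (t M) (w e)) ⟩
        ∑ℚ E (λ e → t M * (y M e * w e))                     ≡⟨ ∑ℚ-*ˡ E (t M) _ ⟩
        t M * yw                                             ∎
        where
        open ≤-Reasoning
        comm : ∀ a b c → a * (b * c) ≡ b * (a * c)
        comm = solve-∀ ℚ-ring

      -- Here `z` packs into capacity 0. By `1≤A` the constant 1 is a cover, and comparing `z` with
      -- it leaves no room for a positive total, while `yw` is non-negative because the weights are.
      z̄≤0 : t M ≡ 0ℚ → z̄ ≤ 0ℚ
      z̄≤0 t≡0 = begin
        z̄                                                ≡⟨ ∑ℚ-cong N (λ i → sym (*-identityʳ (z M i))) ⟩
        ∑ℚ N (λ i → z M i * 1ℚ)                          ≤⟨ ∑ℚ-mono N (λ i → *-monoˡ (0≤z M i) (1≤A i)) ⟩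
        ∑ℚ N (λ i → z M i * ∑ℚ E (A i))                  ≡⟨ ∑ℚ-cong N (λ i → cong (z M i *_) (∑ℚ-cong E λ e → sym (*-identityʳ (A i e)))) ⟩
        ∑ℚ N (λ i → z M i * ∑ℚ E (λ e → A i e * 1ℚ))     ≡⟨ ∑ℚ-bilinear N E A (z M) (λ _ → 1ℚ) ⟩
        ∑ℚ E (λ e → 1ℚ * ∑ℚ N (λ i → A i e * z M i))     ≤⟨ ∑ℚ-mono E (λ e → *-monoˡ (nonNegative⁻¹ 1ℚ) (Az≤tw e)) ⟩
        ∑ℚ E (λ e → 1ℚ * (t M * w e))                    ≡⟨ ∑ℚ-cong E (λ e → trans (*-identityˡ _) (cong (_* w e) t≡0)) ⟩
        ∑ℚ E (λ e → 0ℚ * w e)                            ≡⟨ ∑ℚ-0* E w ⟩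
        0ℚ                                               ∎
        where open ≤-Reasoning

      absurd : ∀ {P : Set} → P
      absurd with <-cmp 0ℚ (t M)
      ... | tri< 0<t _ _ = contradiction (<-≤-trans (*-monoʳ-<-pos (t M) {{positive 0<t}} yw<z̄) tz̄≤tyw) (<-irrefl refl)
      ... | tri> _ _ t<0 = contradiction (<-≤-trans t<0 (0≤t M)) (<-irrefl refl)
      ... | tri≈ _ 0≡t _ = contradiction
        (<-≤-trans yw<z̄ (≤-trans (z̄≤0 (sym 0≡t)) (∑ℚ-nonNeg E λ e → *-nonNeg (0≤y M e) (0≤w e)))) (<-irrefl refl)

  strong-duality : (∀ e → 0ℚ ≤ w e) → (∀ i → 1ℚ ≤ ∑ℚ E (A i)) →
    ∃[ m ] ∃[ g ] (Packing m × Cover g × ∑ℚ E (λ e → g e * w e) ≤ ∑ℚ N m)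
  strong-duality 0≤w 1≤A with farkas (N ℕ.+ E) gens constraints
  ... | inj₂ (r , r∈ , r≡0 , r<0) = Infeasible.absurd 0≤w 1≤A (multipliers r∈) r≡0 r<0
  ... | inj₁ (x , sat) = m , g , (0≤m , packs) , (0≤g , covers) , optimal
    where
    m : Fin N → ℚ
    m i = x (i ↑ˡ E)
    g : Fin E → ℚ
    g e = x (N ↑ʳ e)
    holds : ∀ c → Satisfies x (gens c)
    holds c = sat (all-listed c)
    neg-sum : ∀ n (f x : Fin n → ℚ) → ∑ℚ n (λ i → - f i * x i) ≡ - ∑ℚ n (λ i → f i * x i)
    neg-sum n f x = trans (∑ℚ-cong n λ i → lemma (f i) (x i)) (trans (∑ℚ-*ˡ n (- 1ℚ) _) (lemma′ _))
      where
      lemma : ∀ a b → - a * b ≡ - 1ℚ * (a * b)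
      lemma = solve-∀ ℚ-ring
      lemma′ : ∀ a → - 1ℚ * a ≡ - a
      lemma′ = solve-∀ ℚ-ring
    neg-cancel : ∀ {p q} → - p ≤ - q → q ≤ p
    neg-cancel {p} {q} le = subst₂ _≤_ (lemma q) (lemma p) (neg-antimono-≤ le)
      where
      lemma : ∀ a → - (- a) ≡ a
      lemma = solve-∀ ℚ-ring
    0≤m : ∀ i → 0ℚ ≤ m i
    0≤m i = neg-cancel (subst (_≤ 0ℚ) (trans (block-dot (λ i′ → - δ i i′) (λ _ → 0ℚ) x) (trans (cong₂ _+_
      (trans (neg-sum N (δ i) m) (cong -_ (∑ℚ-δ i m))) (∑ℚ-0* E g)) (+-identityʳ (- m i)))) (holds (m≥0 i)))
    0≤g : ∀ e → 0ℚ ≤ g e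
    0≤g e = neg-cancel (subst (_≤ 0ℚ) (trans (block-dot (λ _ → 0ℚ) (λ e′ → - δ e e′) x) (trans (cong₂ _+_
      (∑ℚ-0* N m) (trans (neg-sum E (δ e) g) (cong -_ (∑ℚ-δ e g)))) (+-identityˡ (- g e)))) (holds (g≥0 e)))
    packs : ∀ e → ∑ℚ N (λ i → A i e * m i) ≤ w e
    packs e = subst (_≤ w e) (trans (block-dot (λ i → A i e) (λ _ → 0ℚ) x) (trans (cong (∑ℚ N (λ i → A i e * m i) +_) (∑ℚ-0* E g)) (+-identityʳ _))) (holds (pack e))
    covers : ∀ i → 1ℚ ≤ ∑ℚ E (λ e → A i e * g e)
    covers i = neg-cancel (subst (_≤ - 1ℚ) (trans (block-dot (λ _ → 0ℚ) (λ e → - A i e) x) (trans (cong₂ _+_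
      (∑ℚ-0* N m) (neg-sum E (A i) g)) (+-identityˡ _))) (holds (cover i)))
    optimal : ∑ℚ E (λ e → g e * w e) ≤ ∑ℚ N m
    optimal = subst₂ _≤_ (trans (cong (_+ ∑ℚ N m) eq) (lemma (∑ℚ N m) _)) (+-identityˡ (∑ℚ N m)) (+-monoˡ-≤ (∑ℚ N m) (holds opt))
      where
      eq : ∑ℚ (N ℕ.+ E) (λ j → block (λ _ → - 1ℚ) w j * x j) ≡ - ∑ℚ N m + ∑ℚ E (λ e → g e * w e)
      eq = trans (block-dot (λ _ → - 1ℚ) w x) (cong₂ _+_
        (trans (neg-sum N (λ _ → 1ℚ) m) (cong -_ (∑ℚ-cong N λ i → *-identityˡ (m i))))
        (∑ℚ-cong E λ e → *-comm (w e) (g e)))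
      lemma : ∀ a b → (- a + b) + a ≡ b
      lemma = solve-∀ ℚ-ring

-- Krivelevich's rounding for an abstract incidence matrix

∑-mono : ∀ n {f g : Fin n → ℕ} → (∀ i → f i ℕ.≤ g i) → ∑ n f ℕ.≤ ∑ n g
∑-mono zero    le = z≤n
∑-mono (suc n) le = ℕ.+-mono-≤ (le zero) (∑-mono n (λ i → le (suc i)))

∑-mono-< : ∀ n {f g : Fin n → ℕ} → (∀ i → f i ℕ.≤ g i) → ∀ i → f i ℕ.< g i → ∑ n f ℕ.< ∑ n g
∑-mono-< (suc n) le zero    lt = ℕ.+-mono-<-≤ lt (∑-mono n (λ i → le (suc i)))
∑-mono-< (suc n) le (suc i) lt = ℕ.+-mono-≤-< (le zero) (∑-mono-< n (λ i → le (suc i)) i lt)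

-- In the application `Π` consists of the maps from V(D) to V(L), `T π e` says that `π` does not
-- send `e` to an arc of `L`, `p` is h - d, and `q` is the probability of `T`. The two lower bounds
-- on `f` are the two terms of the maximum in f(H,L).
module Rounding {N E : ℕ} (A : Fin N → Fin E → Bool)
  {Π : Set} (T : Π → Fin E → Bool) (h p q f : ℚ)
  (nonempty : ∀ i → ∃[ e ] A i e ≡ true)
  (size : ∀ i → ∑ℚ E (λ e → ι (A i e)) ≤ h)
  (size-outside : ∀ π i → ∑ℚ E (λ e → ι (A i e ∧ not (T π e))) ≤ p)
  (0≤h : 0ℚ ≤ h) (0≤q : 0ℚ ≤ q)
  (average : ∀ u → ∃[ π ] (∑ℚ E (λ e → ι (T π e) * u e) ≤ q * ∑ℚ E u))
  (hq≤f : h * q ≤ f) (p≤f : p ≤ f) where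

  Hits : (Fin E → Bool) → Set
  Hits F = ∀ i → ∃[ e ] (A i e ≡ true × F e ≡ true)

  a : Fin N → Fin E → ℚ
  a i e = ι (A i e)

  Rounded : (Fin E → ℚ) → Set
  Rounded w = ∃[ F ] (Hits F × ∃[ m ] (Packing N E a w m × ∑ℚ E (λ e → ι (F e) * w e) ≤ f * ∑ℚ N m))

  0≤f : 0ℚ ≤ f
  0≤f = ≤-trans (*-nonNeg 0≤h 0≤q) hq≤f

  support : (Fin E → ℚ) → ℕ
  support w = ∑ E (λ e → if does (w e ≟ 0ℚ) then 0 else 1)

  erase : Fin E → (Fin E → ℚ) → Fin E → ℚ
  erase e w e′ = if does (e ≟ᶠ e′) then 0ℚ else w e′

  erase-nonNeg : ∀ e {w} → (∀ e → 0ℚ ≤ w e) → ∀ e′ → 0ℚ ≤ erase e w e′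
  erase-nonNeg e 0≤w e′ with does (e ≟ᶠ e′)
  ... | true  = ≤-refl
  ... | false = 0≤w e′

  erase-self : ∀ e w → erase e w e ≡ 0ℚ
  erase-self e w rewrite dec-true (e ≟ᶠ e) refl = refl

  erase-support : ∀ e w → w e ≢ 0ℚ → support (erase e w) ℕ.< support w
  erase-support e w w≢0 = ∑-mono-< E below e strict
    where
    below : ∀ e′ → (if does (erase e w e′ ≟ 0ℚ) then 0 else 1) ℕ.≤ (if does (w e′ ≟ 0ℚ) then 0 else 1)
    below e′ with does (e ≟ᶠ e′)
    ... | true  = z≤n
    ... | false = ℕ.≤-refl
    strict : (if does (erase e w e ≟ 0ℚ) then 0 else 1) ℕ.< (if does (w e ≟ 0ℚ) then 0 else 1)
    strict rewrite erase-self e w | dec-false (w e ≟ 0ℚ) w≢0 = s≤s z≤n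

  Heavy : (g w : Fin E → ℚ) → Fin E → Set
  Heavy g w e = 1ℚ ≤ p * g e × w e ≢ 0ℚ

  -- Being a cover does not depend on the weights, so `g` also bounds the recursive packing `m′`.
  -- Its cost drops by exactly `g e * w e` when `e` is erased, and this amount pays for `e`. The
  -- packing returned is the outer `m`, which is optimal for `w`.
  erase-heavy : ∀ {w} → (∀ e → 0ℚ ≤ w e) → ∀ {m g} → Cover N E a w g →
    ∑ℚ E (λ e → g e * w e) ≤ ∑ℚ N m → Packing N E a w m →
    ∀ e → 1ℚ ≤ p * g e → Rounded (erase e w) → Rounded w
  erase-heavy {w} 0≤w {m} {g} (0≤g , covers) opt pack e heavy (F′ , hits′ , m′ , pack′ , le′) =
    F , hits , m , pack , bound
    where
    b : Fin E → Bool
    b e′ = does (e ≟ᶠ e′)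
    w′ = erase e w
    F : Fin E → Bool
    F e′ = b e′ ∨ F′ e′
    hits : Hits F
    hits i with hits′ i
    ... | e₀ , Ae₀ , F′e₀ = e₀ , Ae₀ , trans (cong (b e₀ ∨_) F′e₀) (Bool.∨-zeroʳ (b e₀))
    split-F : ∀ b c x → ι (b ∨ c) * x ≡ ι c * (if b then 0ℚ else x) + ι b * x
    split-F true  c x = sym (trans (cong (_+ 1ℚ * x) (*-zeroʳ (ι c))) (+-identityˡ _))
    split-F false c x = sym (trans (cong (ι c * x +_) (*-zeroˡ x)) (+-identityʳ _))
    split-w : ∀ b x y → y * x ≡ y * (if b then 0ℚ else x) + ι b * (y * x)
    split-w true  x y = sym (trans (cong₂ _+_ (*-zeroʳ y) (*-identityˡ (y * x))) (+-identityˡ _))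
    split-w false x y = sym (trans (cong (y * x +_) (*-zeroˡ (y * x))) (+-identityʳ _))
    F-sum : ∑ℚ E (λ e → ι (F e) * w e) ≡ ∑ℚ E (λ e → ι (F′ e) * w′ e) + w e
    F-sum = trans (∑ℚ-cong E λ e′ → split-F (b e′) (F′ e′) (w e′))
      (trans (∑ℚ-+ E _ _) (cong (∑ℚ E (λ e → ι (F′ e) * w′ e) +_) (∑ℚ-δ e w)))
    g-sum : ∑ℚ E (λ e → g e * w e) ≡ ∑ℚ E (λ e → g e * w′ e) + g e * w e
    g-sum = trans (∑ℚ-cong E λ e′ → split-w (b e′) (w e′) (g e′))
      (trans (∑ℚ-+ E _ _) (cong (∑ℚ E (λ e → g e * w′ e) +_) (∑ℚ-δ e (λ e → g e * w e))))
    open ≤-Reasoning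
    we≤ : w e ≤ f * (g e * w e)
    we≤ = begin
      w e                ≡⟨ sym (*-identityˡ (w e)) ⟩
      1ℚ * w e           ≤⟨ *-monoʳ (0≤w e) heavy ⟩
      p * g e * w e      ≡⟨ *-assoc p (g e) (w e) ⟩
      p * (g e * w e)    ≤⟨ *-monoʳ (*-nonNeg (0≤g e) (0≤w e)) p≤f ⟩
      f * (g e * w e)    ∎
    bound : ∑ℚ E (λ e → ι (F e) * w e) ≤ f * ∑ℚ N m
    bound = begin
      ∑ℚ E (λ e → ι (F e) * w e)                          ≡⟨ F-sum ⟩
      ∑ℚ E (λ e → ι (F′ e) * w′ e) + w e                  ≤⟨ +-mono-≤ le′ we≤ ⟩
      f * ∑ℚ N m′ + f * (g e * w e)                       ≤⟨ +-monoˡ-≤ (f * (g e * w e)) (*-monoˡ 0≤f (weak-duality N E a w′ pack′ (0≤g , covers))) ⟩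
      f * ∑ℚ E (λ e → g e * w′ e) + f * (g e * w e)       ≡⟨ sym (*-distribˡ-+ f _ (g e * w e)) ⟩
      f * (∑ℚ E (λ e → g e * w′ e) + g e * w e)           ≡⟨ cong (f *_) (sym g-sum) ⟩
      f * ∑ℚ E (λ e → g e * w e)                          ≤⟨ *-monoˡ 0≤f opt ⟩
      f * ∑ℚ N m                                          ∎

  module Light {w : Fin E → ℚ} {m g} (pack : Packing N E a w m)
    (cov : Cover N E a w g) (opt : ∑ℚ E (λ e → g e * w e) ≤ ∑ℚ N m)
    (light : ∀ e → ¬ Heavy g w e) where

    u : Fin E → ℚ
    u e = if does (0ℚ <? g e) then w e else 0ℚ

    π = proj₁ (average u)

    -- By `light` the first disjunct admits only arcs of weight 0, such as those erased earlier, and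
    -- so costs nothing. It ensures that `p * g e < 1` on every arc of a copy avoiding `F`.
    F : Fin E → Bool
    F e = does (1ℚ ≤? p * g e) ∨ (T π e ∧ does (0ℚ <? g e))

    u≤load : ∀ e → u e ≤ ∑ℚ N (λ i → a i e * m i)
    u≤load e = go (0ℚ <? g e)
      where
      go : (d : Dec (0ℚ < g e)) → (if does d then w e else 0ℚ) ≤ ∑ℚ N (λ i → a i e * m i)
      go (yes 0<g) = slackness N E a w pack cov opt e 0<g
      go (no  _)   = ∑ℚ-nonNeg N (λ i → *-nonNeg (0≤ι (A i e)) (proj₁ pack i))

    ∑u≤ : ∑ℚ E u ≤ h * ∑ℚ N m
    ∑u≤ = begin
      ∑ℚ E u                                        ≤⟨ ∑ℚ-mono E u≤load ⟩
      ∑ℚ E (λ e → ∑ℚ N (λ i → a i e * m i))         ≡⟨ sym (∑ℚ-swap N E _) ⟩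
      ∑ℚ N (λ i → ∑ℚ E (λ e → a i e * m i))         ≡⟨ ∑ℚ-cong N (λ i → ∑ℚ-*ʳ E (m i) (a i)) ⟩
      ∑ℚ N (λ i → ∑ℚ E (a i) * m i)                 ≤⟨ ∑ℚ-mono N (λ i → *-monoʳ (proj₁ pack i) (size i)) ⟩
      ∑ℚ N (λ i → h * m i)                          ≡⟨ ∑ℚ-*ˡ N h m ⟩
      h * ∑ℚ N m                                    ∎
      where open ≤-Reasoning

    ∧-*-if : ∀ b c x → ι (b ∧ c) * x ≡ ι b * (if c then x else 0ℚ)
    ∧-*-if true  true  x = refl
    ∧-*-if true  false x = trans (*-zeroˡ x) (sym (*-zeroʳ 1ℚ))
    ∧-*-if false c     x = trans (*-zeroˡ x) (sym (*-zeroˡ (if c then x else 0ℚ)))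

    F-weight : ∀ e → ι (F e) * w e ≡ ι (T π e) * u e
    F-weight e = go (1ℚ ≤? p * g e) (w e ≟ 0ℚ) (does (0ℚ <? g e))
      where
      go : (d : Dec (1ℚ ≤ p * g e)) → Dec (w e ≡ 0ℚ) → ∀ c →
        ι (does d ∨ (T π e ∧ c)) * w e ≡ ι (T π e) * (if c then w e else 0ℚ)
      go (no  _)    _         c = ∧-*-if (T π e) c (w e)
      go (yes 1≤pg) (no  w≢0) c = contradiction (1≤pg , w≢0) (light e)
      go (yes _)    (yes w≡0) c rewrite w≡0 =
        sym (trans (cong (ι (T π e) *_) (Bool.if-eta c)) (*-zeroʳ (ι (T π e))))

    bound : ∑ℚ E (λ e → ι (F e) * w e) ≤ f * ∑ℚ N m
    bound = begin
      ∑ℚ E (λ e → ι (F e) * w e)      ≡⟨ ∑ℚ-cong E F-weight ⟩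
      ∑ℚ E (λ e → ι (T π e) * u e)    ≤⟨ proj₂ (average u) ⟩
      q * ∑ℚ E u                      ≤⟨ *-monoˡ 0≤q ∑u≤ ⟩
      q * (h * ∑ℚ N m)                ≡⟨ rearrange q h (∑ℚ N m) ⟩
      h * q * ∑ℚ N m                  ≤⟨ *-monoʳ (∑ℚ-nonNeg N (proj₁ pack)) hq≤f ⟩
      f * ∑ℚ N m                      ∎
      where
      open ≤-Reasoning
      rearrange : ∀ a b c → a * (b * c) ≡ b * a * c
      rearrange = solve-∀ ℚ-ring

    -- The terms `o e * (1ℚ - p * g e)` are non-negative, and their sum is the sum of `o` minus `p`
    -- times the sum of `o e * g e`, hence at most p - p = 0. As the second factor is positive on
    -- the copy, `o` vanishes there, against `1≤og`. This is the comparison of `g e` with 1/p in a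
    -- form that includes p = 0.
    module Missed (i : Fin N) (miss : ∀ e → A i e ≡ true → F e ≢ true) where

      o : Fin E → ℚ
      o e = ι (A i e ∧ not (T π e))

      pg<1 : ∀ e → A i e ≡ true → p * g e < 1ℚ
      pg<1 e Ae = go (1ℚ ≤? p * g e) (miss e Ae)
        where
        go : ∀ {c} (d : Dec (1ℚ ≤ p * g e)) → does d ∨ c ≢ true → p * g e < 1ℚ
        go (yes _)    F≢ = contradiction refl F≢
        go (no  1≰pg) _  = ≰⇒> 1≰pg

      g≤0 : ∀ e → A i e ≡ true → T π e ≡ true → g e ≤ 0ℚ
      g≤0 e Ae Te = go (0ℚ <? g e) (miss e Ae)
        where
        go : ∀ {c} (d : Dec (0ℚ < g e)) → c ∨ (T π e ∧ does d) ≢ true → g e ≤ 0ℚ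
        go (no  0≮g) _  = ≮⇒≥ 0≮g
        go {c} (yes _)   F≢ rewrite Te = contradiction (Bool.∨-zeroʳ c) F≢

      ag≤og : ∀ e → a i e * g e ≤ o e * g e
      ag≤og e = go (A i e) (T π e) refl refl
        where
        go : ∀ b c → A i e ≡ b → T π e ≡ c → ι b * g e ≤ ι (b ∧ not c) * g e
        go false c     _  _  = ≤-refl
        go true  false _  _  = ≤-refl
        go true  true  Ae Te = subst₂ _≤_ (sym (*-identityˡ (g e))) (sym (*-zeroˡ (g e))) (g≤0 e Ae Te)

      1≤og : 1ℚ ≤ ∑ℚ E (λ e → o e * g e)
      1≤og = ≤-trans (proj₂ cov i) (∑ℚ-mono E ag≤og)

      0≤p : 0ℚ ≤ p
      0≤p = ≤-trans (∑ℚ-nonNeg E (λ e → 0≤ι _)) (size-outside π i)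

      gap : Fin E → ℚ
      gap e = o e * (1ℚ - p * g e)

      0≤gap : ∀ e → 0ℚ ≤ gap e
      0≤gap e with A i e in Ae
      ... | true  = *-nonNeg (0≤ι (not (T π e))) (≤⇒0≤- (<⇒≤ (pg<1 e Ae)))
      ... | false = ≤-reflexive (sym (*-zeroˡ (1ℚ - p * g e)))

      ∑gap≤0 : ∑ℚ E gap ≤ 0ℚ
      ∑gap≤0 = begin
        ∑ℚ E gap                                           ≡⟨ cancel (∑ℚ E gap) P ⟩
        (∑ℚ E gap + P) - P                                 ≡⟨ cong (_- P) (sym o-sum) ⟩
        ∑ℚ E o - P                                         ≤⟨ +-mono-≤ (size-outside π i) (neg-antimono-≤ p≤P) ⟩
        p - p                                              ≡⟨ +-inverseʳ p ⟩
        0ℚ                                                 ∎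
        where
        open ≤-Reasoning
        P = p * ∑ℚ E (λ e → o e * g e)
        cancel : ∀ a b → a ≡ (a + b) - b
        cancel = solve-∀ ℚ-ring
        expand : ∀ o p g → o ≡ o * (1ℚ - p * g) + p * (o * g)
        expand = solve-∀ ℚ-ring
        o-sum : ∑ℚ E o ≡ ∑ℚ E gap + P
        o-sum = trans (∑ℚ-cong E λ e → expand (o e) p (g e))
          (trans (∑ℚ-+ E gap _) (cong (∑ℚ E gap +_) (∑ℚ-*ˡ E p _)))
        p≤P : p ≤ P
        p≤P = subst (_≤ P) (*-identityʳ p) (*-monoˡ 0≤p 1≤og)

      og≤0 : ∀ e → o e * g e ≤ 0ℚ
      og≤0 e = go (A i e) (T π e) refl refl
        where
        go : ∀ b c → A i e ≡ b → T π e ≡ c → ι (b ∧ not c) * g e ≤ 0ℚ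
        go false c     _  _  = ≤-reflexive (*-zeroˡ (g e))
        go true  true  _  _  = ≤-reflexive (*-zeroˡ (g e))
        go true  false Ae Te = contradiction
          (<-≤-trans (pg<1 e Ae) (0≤-⇒≤ (subst (0ℚ ≤_) (swap-sub 1ℚ (p * g e)) (neg-antimono-≤ gap≤0))))
          (<-irrefl refl)
          where
          swap-sub : ∀ a b → - (a - b) ≡ b - a
          swap-sub = solve-∀ ℚ-ring
          o≡1 : o e ≡ 1ℚ
          o≡1 rewrite Ae | Te = refl
          gap≤0 : 1ℚ - p * g e ≤ 0ℚ
          gap≤0 = subst (_≤ 0ℚ) (trans (cong (_* (1ℚ - p * g e)) o≡1) (*-identityˡ _))
            (≤-trans (term≤∑ℚ E 0≤gap e) ∑gap≤0)

      absurd : ∀ {P : Set} → P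
      absurd = contradiction
        (<-≤-trans (positive⁻¹ 1ℚ) (≤-trans 1≤og (≤-trans (∑ℚ-mono E og≤0) (≤-reflexive (∑ℚ-zero E)))))
        (<-irrefl refl)

    hits : Hits F
    hits i with any? (λ e → (A i e Bool.≟ true) ×-dec (F e Bool.≟ true))
    ... | yes hit = hit
    ... | no  ¬hit = Missed.absurd i (λ e Ae Fe → ¬hit (e , Ae , Fe))

    rounded : Rounded w
    rounded = F , hits , m , pack , bound

  1≤size : ∀ i → 1ℚ ≤ ∑ℚ E (a i)
  1≤size i with nonempty i
  ... | e , Ae = subst (λ b → ι b ≤ ∑ℚ E (a i)) Ae (term≤∑ℚ E (λ e → 0≤ι (A i e)) e)

  rounding-acc : ∀ w → (∀ e → 0ℚ ≤ w e) → Acc ℕ._<_ (support w) → Rounded w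
  rounding-acc w 0≤w (acc smaller) with strong-duality N E a w 0≤w 1≤size
  ... | m , g , pack , cov , opt with any? (λ e → (1ℚ ≤? p * g e) ×-dec ¬? (w e ≟ 0ℚ))
  ...   | yes (e , 1≤pg , w≢0) = erase-heavy 0≤w {g = g} cov opt pack e 1≤pg
    (rounding-acc (erase e w) (erase-nonNeg e 0≤w) (smaller (erase-support e w w≢0)))
  ...   | no  light = Light.rounded pack cov opt (λ e heavy → light (e , heavy))

  rounding : ∀ w → (∀ e → 0ℚ ≤ w e) → Rounded w
  rounding w 0≤w = rounding-acc w 0≤w (<-wellFounded (support w))

-- Natural numbers as rationals

ℕ→ℚ-+ : ∀ a b → ℕ→ℚ (a ℕ.+ b) ≡ ℕ→ℚ a + ℕ→ℚ b
-- Rationals are kept in lowest terms, which blocks computation; over unnormalised fractions this is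
-- an identity of integers.
ℕ→ℚ-+ a b = toℚᵘ-injective (begin
  toℚᵘ (ℕ→ℚ (a ℕ.+ b))               ≈⟨ toℚᵘ-fromℚᵘ (mkℚᵘ (ℕ→ℤ (a ℕ.+ b)) 0) ⟩
  mkℚᵘ (ℕ→ℤ (a ℕ.+ b)) 0               ≈⟨ *≡* (lemma (ℕ→ℤ a) (ℕ→ℤ b)) ⟩
  mkℚᵘ (ℕ→ℤ a) 0 ℚᵘ.+ mkℚᵘ (ℕ→ℤ b) 0     ≈⟨ ℚᵘ.+-cong (toℚᵘ-fromℚᵘ (mkℚᵘ (ℕ→ℤ a) 0)) (toℚᵘ-fromℚᵘ (mkℚᵘ (ℕ→ℤ b) 0)) ⟨
  toℚᵘ (ℕ→ℚ a) ℚᵘ.+ toℚᵘ (ℕ→ℚ b)     ≈⟨ toℚᵘ-homo-+ (ℕ→ℚ a) (ℕ→ℚ b) ⟨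
  toℚᵘ (ℕ→ℚ a + ℕ→ℚ b)               ∎)
  where
  open ℚᵘ.≃-Reasoning
  lemma : ∀ a b → (a ℤ.+ b) ℤ.* (ℕ→ℤ 1) ≡ (a ℤ.* ℕ→ℤ 1 ℤ.+ b ℤ.* ℕ→ℤ 1) ℤ.* ℕ→ℤ 1
  lemma = ℤ-Solver.solve-∀

0≤ℕ→ℚ : ∀ n → 0ℚ ≤ ℕ→ℚ n
0≤ℕ→ℚ zero    = ≤-refl
0≤ℕ→ℚ (suc n) = subst (0ℚ ≤_) (sym (ℕ→ℚ-+ 1 n)) (+-nonNeg (nonNegative⁻¹ 1ℚ) (0≤ℕ→ℚ n))

ℕ→ℚ-mono : ∀ {a b} → a ℕ.≤ b → ℕ→ℚ a ≤ ℕ→ℚ b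
ℕ→ℚ-mono {b = b} z≤n = 0≤ℕ→ℚ b
ℕ→ℚ-mono (s≤s {a} {b} a≤b) = subst₂ _≤_ (sym (ℕ→ℚ-+ 1 a)) (sym (ℕ→ℚ-+ 1 b)) (+-monoʳ-≤ 1ℚ (ℕ→ℚ-mono a≤b))

ℕ→ℚ-∑ : ∀ n (f : Fin n → ℕ) → ℕ→ℚ (∑ n f) ≡ ∑ℚ n (λ i → ℕ→ℚ (f i))
ℕ→ℚ-∑ zero    f = refl
ℕ→ℚ-∑ (suc n) f = trans (ℕ→ℚ-+ (f zero) _) (cong (ℕ→ℚ (f zero) +_) (ℕ→ℚ-∑ n _))

ℕ→ℚ-if : ∀ b → ℕ→ℚ (if b then 1 else 0) ≡ ι b
ℕ→ℚ-if true  = refl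
ℕ→ℚ-if false = refl

∑ℚ-const : ∀ n c → ∑ℚ n (λ _ → c) ≡ ℕ→ℚ n * c
∑ℚ-const zero    c = sym (*-zeroˡ c)
∑ℚ-const (suc n) c = begin
  c + ∑ℚ n (λ _ → c)      ≡⟨ cong₂ _+_ (sym (*-identityˡ c)) (∑ℚ-const n c) ⟩
  1ℚ * c + ℕ→ℚ n * c      ≡⟨ sym (*-distribʳ-+ c 1ℚ (ℕ→ℚ n)) ⟩
  (1ℚ + ℕ→ℚ n) * c        ≡⟨ cong (_* c) (sym (ℕ→ℚ-+ 1 n)) ⟩
  ℕ→ℚ (suc n) * c         ∎
  where open ≡-Reasoning

argmin : ∀ {n} (f : Fin (suc n) → ℚ) → ∃[ a ] (∀ b → f a ≤ f b)
argmin {zero}  f = zero , λ { zero → ≤-refl }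
argmin {suc n} f with argmin (λ i → f (suc i))
... | a , min with ≤-total (f zero) (f (suc a))
...   | inj₁ le = zero , λ { zero → ≤-refl ; (suc b) → ≤-trans le (min b) }
...   | inj₂ le = suc a , λ { zero → le ; (suc b) → min b }

-- Averaging over all maps from an n-set to Fin (suc k)

module Average (k : ℕ) where

  K : ℕ
  K = suc k

  1/K : ℚ
  1/K = ℕ→ℤ 1 / K

  1/K-inverse : 1/K * ℕ→ℚ K ≡ 1ℚ
  1/K-inverse = toℚᵘ-injective (begin
    toℚᵘ (1/K * ℕ→ℚ K)                 ≈⟨ toℚᵘ-homo-* 1/K (ℕ→ℚ K) ⟩
    toℚᵘ 1/K ℚᵘ.* toℚᵘ (ℕ→ℚ K)         ≈⟨ ℚᵘ.*-cong (toℚᵘ-fromℚᵘ (mkℚᵘ (ℕ→ℤ 1) k)) (toℚᵘ-fromℚᵘ (mkℚᵘ (ℕ→ℤ K) 0)) ⟩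
    mkℚᵘ (ℕ→ℤ 1) k ℚᵘ.* mkℚᵘ (ℕ→ℤ K) 0     ≈⟨ *≡* (trans (lemma (ℕ→ℤ K)) (cong (ℕ→ℤ 1 ℤ.*_) (sym (ℤ.pos-* K 1)))) ⟩
    toℚᵘ 1ℚ                            ∎)
    where
    open ℚᵘ.≃-Reasoning
    lemma : ∀ K → (ℕ→ℤ 1 ℤ.* K) ℤ.* ℕ→ℤ 1 ≡ ℕ→ℤ 1 ℤ.* (K ℤ.* ℕ→ℤ 1)
    lemma = ℤ-Solver.solve-∀

  0≤1/K : 0ℚ ≤ 1/K
  0≤1/K = nonNegative⁻¹ 1/K {{normalize-nonNeg 1 K}}

  density≡ : ∀ e → density e K ≡ 1/K * (1/K * ℕ→ℚ e)
  density≡ e = toℚᵘ-injective (begin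
    toℚᵘ (density e K)                             ≈⟨ toℚᵘ-fromℚᵘ (mkℚᵘ (ℕ→ℤ e) (k ℕ.+ k ℕ.* K)) ⟩
    mkℚᵘ (ℕ→ℤ e) (k ℕ.+ k ℕ.* K)                     ≈⟨ *≡* eq ⟩
    mkℚᵘ (ℕ→ℤ 1) k ℚᵘ.* (mkℚᵘ (ℕ→ℤ 1) k ℚᵘ.* mkℚᵘ (ℕ→ℤ e) 0)
      ≈⟨ ℚᵘ.*-cong (toℚᵘ-fromℚᵘ (mkℚᵘ (ℕ→ℤ 1) k)) (ℚᵘ.*-cong (toℚᵘ-fromℚᵘ (mkℚᵘ (ℕ→ℤ 1) k)) (toℚᵘ-fromℚᵘ (mkℚᵘ (ℕ→ℤ e) 0))) ⟨
    toℚᵘ 1/K ℚᵘ.* (toℚᵘ 1/K ℚᵘ.* toℚᵘ (ℕ→ℚ e))     ≈⟨ ℚᵘ.*-congˡ {toℚᵘ 1/K} (toℚᵘ-homo-* 1/K (ℕ→ℚ e)) ⟨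
    toℚᵘ 1/K ℚᵘ.* toℚᵘ (1/K * ℕ→ℚ e)               ≈⟨ toℚᵘ-homo-* 1/K (1/K * ℕ→ℚ e) ⟨
    toℚᵘ (1/K * (1/K * ℕ→ℚ e))                     ∎)
    where
    open ℚᵘ.≃-Reasoning
    lemma : ∀ e K → e ℤ.* (K ℤ.* (K ℤ.* ℕ→ℤ 1)) ≡ (ℕ→ℤ 1 ℤ.* (ℕ→ℤ 1 ℤ.* e)) ℤ.* (K ℤ.* K)
    lemma = ℤ-Solver.solve-∀
    eq : ℕ→ℤ e ℤ.* ℕ→ℤ (K ℕ.* (K ℕ.* 1)) ≡ (ℕ→ℤ 1 ℤ.* (ℕ→ℤ 1 ℤ.* ℕ→ℤ e)) ℤ.* ℕ→ℤ (K ℕ.* K)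
    eq = trans (cong (ℕ→ℤ e ℤ.*_) (trans (ℤ.pos-* K (K ℕ.* 1)) (cong (ℕ→ℤ K ℤ.*_) (ℤ.pos-* K 1))))
      (trans (lemma (ℕ→ℤ e) (ℕ→ℤ K)) (cong ((ℕ→ℤ 1 ℤ.* (ℕ→ℤ 1 ℤ.* ℕ→ℤ e)) ℤ.*_) (sym (ℤ.pos-* K K))))

  avg : (Fin K → ℚ) → ℚ
  avg f = 1/K * ∑ℚ K f

  avg-cong : ∀ {f g} → (∀ a → f a ≡ g a) → avg f ≡ avg g
  avg-cong eq = cong (1/K *_) (∑ℚ-cong K eq)

  avg-mono : ∀ {f g} → (∀ a → f a ≤ g a) → avg f ≤ avg g
  avg-mono le = *-monoˡ 0≤1/K (∑ℚ-mono K le)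

  avg-const : ∀ c → avg (λ _ → c) ≡ c
  avg-const c = trans (cong (1/K *_) (∑ℚ-const K c))
    (trans (sym (*-assoc 1/K (ℕ→ℚ K) c)) (trans (cong (_* c) 1/K-inverse) (*-identityˡ c)))

  avg-+ : ∀ f g → avg (λ a → f a + g a) ≡ avg f + avg g
  avg-+ f g = trans (cong (1/K *_) (∑ℚ-+ K f g)) (*-distribˡ-+ 1/K _ _)

  avg-*ʳ : ∀ f c → avg (λ a → f a * c) ≡ avg f * c
  avg-*ʳ f c = trans (cong (1/K *_) (∑ℚ-*ʳ K c f)) (sym (*-assoc 1/K _ c))

  avg-∑ : ∀ n (f : Fin n → Fin K → ℚ) → avg (λ a → ∑ℚ n (λ i → f i a)) ≡ ∑ℚ n (λ i → avg (f i))
  avg-∑ n f = trans (cong (1/K *_) (∑ℚ-swap K n (λ a i → f i a))) (sym (∑ℚ-*ˡ n 1/K _))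

  avg-swap : ∀ (f : Fin K → Fin K → ℚ) → avg (λ a → avg (f a)) ≡ avg (λ b → avg (λ a → f a b))
  avg-swap f = trans (cong (1/K *_) (∑ℚ-*ˡ K 1/K (λ a → ∑ℚ K (f a))))
    (trans (cong (λ s → 1/K * (1/K * s)) (∑ℚ-swap K K f)) (cong (1/K *_) (sym (∑ℚ-*ˡ K 1/K (λ b → ∑ℚ K (λ a → f a b))))))

  ∃≤avg : ∀ f → ∃[ a ] (f a ≤ avg f)
  ∃≤avg f with argmin f
  ... | a , min = a , subst (_≤ avg f) (avg-const (f a)) (avg-mono min)

  -- Expectation over a uniformly random vector, taken one coordinate at a time; independence of the
  -- coordinates then holds by the shape of the definition.
  𝔼 : ∀ n → (Vec (Fin K) n → ℚ) → ℚ
  𝔼 zero    W = W []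
  𝔼 (suc n) W = avg (λ a → 𝔼 n (λ π → W (a ∷ π)))

  -- Method of conditional expectations: the coordinates are fixed in turn, each at a value that
  -- does not raise the mean.
  ∃≤𝔼 : ∀ n W → ∃[ π ] (W π ≤ 𝔼 n W)
  ∃≤𝔼 zero    W = [] , ≤-refl
  ∃≤𝔼 (suc n) W =
    let (a , le)  = ∃≤avg (λ a → 𝔼 n (λ π → W (a ∷ π)))
        (π , le′) = ∃≤𝔼 n (λ π → W (a ∷ π))
    in a ∷ π , ≤-trans le′ le

  𝔼-const : ∀ n c → 𝔼 n (λ _ → c) ≡ c
  𝔼-const zero    c = refl
  𝔼-const (suc n) c = trans (avg-cong λ _ → 𝔼-const n c) (avg-const c)

  𝔼-*ʳ : ∀ n W c → 𝔼 n (λ π → W π * c) ≡ 𝔼 n W * c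
  𝔼-*ʳ zero    W c = refl
  𝔼-*ʳ (suc n) W c = trans (avg-cong λ a → 𝔼-*ʳ n (λ π → W (a ∷ π)) c) (avg-*ʳ (λ a → 𝔼 n (λ π → W (a ∷ π))) c)

  𝔼-∑ : ∀ n m (W : Fin m → Vec (Fin K) n → ℚ) → 𝔼 n (λ π → ∑ℚ m (λ i → W i π)) ≡ ∑ℚ m (λ i → 𝔼 n (W i))
  𝔼-∑ zero    m W = refl
  𝔼-∑ (suc n) m W = trans (avg-cong λ a → 𝔼-∑ n m (λ i π → W i (a ∷ π))) (avg-∑ m (λ i a → 𝔼 n (λ π → W i (a ∷ π))))

  𝔼-lookup : ∀ n i (f : Fin K → ℚ) → 𝔼 n (λ π → f (lookup π i)) ≡ avg f
  𝔼-lookup (suc n) zero    f = avg-cong λ a → 𝔼-const n (f a)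
  𝔼-lookup (suc n) (suc i) f = trans (avg-cong λ a → 𝔼-lookup n i f) (avg-const (avg f))

  -- Distinct coordinates are independent. This is where the absence of loops in `D` enters: the two
  -- ends of an arc receive independent images.
  𝔼-lookup₂ : ∀ n {i j} → i ≢ j → (f : Fin K → Fin K → ℚ) →
    𝔼 n (λ π → f (lookup π i) (lookup π j)) ≡ avg (λ a → avg (f a))
  𝔼-lookup₂ (suc n) {zero}  {zero}  i≢j f = contradiction refl i≢j
  𝔼-lookup₂ (suc n) {zero}  {suc j} i≢j f = avg-cong λ a → 𝔼-lookup n j (f a)
  𝔼-lookup₂ (suc n) {suc i} {zero}  i≢j f =
    trans (avg-cong λ b → 𝔼-lookup n i (λ a → f a b)) (sym (avg-swap f))
  𝔼-lookup₂ (suc n) {suc i} {suc j} i≢j f =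
    trans (avg-cong λ _ → 𝔼-lookup₂ n (λ eq → i≢j (cong suc eq)) f) (avg-const _)

  module _ (adjᴸ : Fin K → Fin K → Bool) where

    -- The two ends of an arc may receive the same image, so the average runs over all ordered pairs
    -- including the diagonal; hence the denominator |V(L)|².
    missProb : ℚ
    missProb = avg (λ a → avg (λ b → ι (not (adjᴸ a b))))

    0≤missProb : 0ℚ ≤ missProb
    0≤missProb = subst (_≤ missProb) (trans (avg-cong λ _ → avg-const 0ℚ) (avg-const 0ℚ))
      (avg-mono λ a → avg-mono λ b → 0≤ι (not (adjᴸ a b)))

    missProb≡ : missProb ≡ 1ℚ - density (∑ K λ a → ∑ K λ b → if adjᴸ a b then 1 else 0) K
    missProb≡ = trans (shift missProb (avg hit)) (cong₂ _-_ total hit≡)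
      where
      miss hit : Fin K → ℚ
      miss a = avg (λ b → ι (not (adjᴸ a b)))
      hit a = avg (λ b → ι (adjᴸ a b))
      arcs : Fin K → ℕ
      arcs a = ∑ K λ b → if adjᴸ a b then 1 else 0
      arcs≡ : ∀ a → ℕ→ℚ (arcs a) ≡ ∑ℚ K (λ b → ι (adjᴸ a b))
      arcs≡ a = trans (ℕ→ℚ-∑ K (λ b → if adjᴸ a b then 1 else 0)) (∑ℚ-cong K λ b → ℕ→ℚ-if (adjᴸ a b))
      shift : ∀ p q → p ≡ (p + q) - q
      shift = solve-∀ ℚ-ring
      ι-not : ∀ b → ι (not b) + ι b ≡ 1ℚ
      ι-not true  = refl
      ι-not false = refl
      miss+hit : ∀ a → miss a + hit a ≡ 1ℚ
      miss+hit a = trans (sym (avg-+ (λ b → ι (not (adjᴸ a b))) (λ b → ι (adjᴸ a b))))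
        (trans (avg-cong λ b → ι-not (adjᴸ a b)) (avg-const 1ℚ))
      total : missProb + avg hit ≡ 1ℚ
      total = trans (sym (avg-+ miss hit)) (trans (avg-cong miss+hit) (avg-const 1ℚ))
      hit≡ : avg hit ≡ density (∑ K arcs) K
      hit≡ = sym (begin
        density (∑ K arcs) K                                     ≡⟨ density≡ (∑ K arcs) ⟩
        1/K * (1/K * ℕ→ℚ (∑ K arcs))                             ≡⟨ cong (λ s → 1/K * (1/K * s)) (ℕ→ℚ-∑ K arcs) ⟩
        1/K * (1/K * ∑ℚ K (λ a → ℕ→ℚ (arcs a)))                  ≡⟨ cong (1/K *_) (sym (∑ℚ-*ˡ K 1/K (λ a → ℕ→ℚ (arcs a)))) ⟩
        avg (λ a → 1/K * ℕ→ℚ (arcs a))                           ≡⟨ avg-cong (λ a → cong (1/K *_) (arcs≡ a)) ⟩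
        avg hit                                                  ∎)
        where open ≡-Reasoning

    ∃-cheap-map : ∀ {n E} (s t : Fin E → Fin n) → (∀ e → s e ≢ t e) → (u : Fin E → ℚ) →
      ∃[ π ] (∑ℚ E (λ e → ι (not (adjᴸ (lookup π (s e)) (lookup π (t e)))) * u e) ≤ missProb * ∑ℚ E u)
    ∃-cheap-map {n} {E} s t s≢t u with ∃≤𝔼 n (λ π → ∑ℚ E (λ e → ι (not (adjᴸ (lookup π (s e)) (lookup π (t e)))) * u e))
    ... | π , le = π , ≤-trans le (≤-reflexive (begin
      𝔼 n (λ π → ∑ℚ E (λ e → ι (not (adjᴸ (lookup π (s e)) (lookup π (t e)))) * u e)) ≡⟨ 𝔼-∑ n E _ ⟩
      ∑ℚ E (λ e → 𝔼 n (λ π → ι (not (adjᴸ (lookup π (s e)) (lookup π (t e)))) * u e)) ≡⟨ ∑ℚ-cong E (λ e → 𝔼-*ʳ n _ (u e)) ⟩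
      ∑ℚ E (λ e → 𝔼 n (λ π → ι (not (adjᴸ (lookup π (s e)) (lookup π (t e))))) * u e)
        ≡⟨ ∑ℚ-cong E (λ e → cong (_* u e) (𝔼-lookup₂ n (s≢t e) (λ a b → ι (not (adjᴸ a b))))) ⟩
      ∑ℚ E (λ e → missProb * u e)                                                     ≡⟨ ∑ℚ-*ˡ E missProb u ⟩
      missProb * ∑ℚ E u                                                               ∎))
      where open ≡-Reasoning

-- Copies of H are decidable

-- Vectors, unlike functions, can be searched exhaustively without function extensionality.
∃Vec? : ∀ {m} n {P : Vec (Fin m) n → Set} → (∀ v → Dec (P v)) → Dec (∃ P)
∃Vec? zero    P? = map′ (λ p → [] , p) (λ { ([] , p) → p }) (P? [])
∃Vec? (suc n) P? = map′ (λ { (a , v , p) → a ∷ v , p }) (λ { (a ∷ v , p) → a , v , p })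
  (any? λ a → ∃Vec? n λ v → P? (a ∷ v))

module _ (H : Digraph) (D : WMultigraph) (U : Subset (nVert D)) (S : Subset (nArc D)) where

  -- The arc map of a copy is determined by its vertex map, because S contains
  -- exactly one arc for each arc of H.
  record VertexMap (φ : Vec (Fin (nVert D)) (nV H)) : Set where
    constructor vertexMap
    field
      injective : ∀ x y → lookup φ x ≡ lookup φ y → x ≡ y
      onto      : ∀ v → lookup U v ≡ true → ∃[ x ] lookup φ x ≡ v
      into      : ∀ x → lookup U (lookup φ x) ≡ true
      image     : ∀ x y → adj H x y ≡ true →
        ∃[ e ] (lookup S e ≡ true × tail D e ≡ lookup φ x × head D e ≡ lookup φ y)
      preimage  : ∀ e → lookup S e ≡ true →
        ∃[ x ] ∃[ y ] (adj H x y ≡ true × tail D e ≡ lookup φ x × head D e ≡ lookup φ y)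
      simple    : ∀ e e′ → lookup S e ≡ true → lookup S e′ ≡ true →
        tail D e ≡ tail D e′ → head D e ≡ head D e′ → e ≡ e′

  vertexMap? : ∀ φ → Dec (VertexMap φ)
  vertexMap? φ = map′
    (λ (a , b , c , d , e , f) → vertexMap a b c d e f)
    (λ (vertexMap a b c d e f) → a , b , c , d , e , f)
    (  (all? λ x → all? λ y → (lookup φ x ≟ᶠ lookup φ y) →-dec (x ≟ᶠ y))
    ×-dec (all? λ v → (lookup U v Bool.≟ true) →-dec any? λ x → lookup φ x ≟ᶠ v)
    ×-dec (all? λ x → lookup U (lookup φ x) Bool.≟ true)
    ×-dec (all? λ x → all? λ y → (adj H x y Bool.≟ true) →-dec any? λ e →
      (lookup S e Bool.≟ true) ×-dec (tail D e ≟ᶠ lookup φ x) ×-dec (head D e ≟ᶠ lookup φ y))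
    ×-dec (all? λ e → (lookup S e Bool.≟ true) →-dec any? λ x → any? λ y →
      (adj H x y Bool.≟ true) ×-dec (tail D e ≟ᶠ lookup φ x) ×-dec (head D e ≟ᶠ lookup φ y))
    ×-dec (all? λ e → all? λ e′ → (lookup S e Bool.≟ true) →-dec (lookup S e′ Bool.≟ true) →-dec
      (tail D e ≟ᶠ tail D e′) →-dec (head D e ≟ᶠ head D e′) →-dec (e ≟ᶠ e′)))

  -- Arcs of `H` carry a proof of adjacency; equality proofs in `Bool` are unique, so the ends
  -- determine the arc.
  arc-≡ : ∀ {x y x′ y′} {p : adj H x y ≡ true} {p′ : adj H x′ y′ ≡ true} →
    x ≡ x′ → y ≡ y′ → _≡_ {A = Arc H} ((x , y) , p) ((x′ , y′) , p′)
  arc-≡ {p = p} {p′} refl refl = cong (_ ,_) (Decidable⇒UIP.≡-irrelevant Bool._≟_ p p′)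

  vertexMap⇒copy : ∃ VertexMap → IsCopy H D U S
  vertexMap⇒copy (φ , M) = lookup φ , ψ , (λ {x} {y} → injective x y) , ψ-injective , ends ,
    (λ v → mk⇔ (onto v) λ { (x , refl) → into x }) ,
    λ e → mk⇔ (ψ-onto e) λ { (a , refl) → proj₁ (proj₂ (image _ _ (proj₂ a))) }
    where
    open VertexMap M
    ψ : Arc H → Fin (nArc D)
    ψ ((x , y) , p) = proj₁ (image x y p)
    ends : ∀ a → tail D (ψ a) ≡ lookup φ (proj₁ (proj₁ a)) × head D (ψ a) ≡ lookup φ (proj₂ (proj₁ a))
    ends ((x , y) , p) = proj₂ (proj₂ (image x y p))
    ψ-injective : Injective _≡_ _≡_ ψ
    ψ-injective {a} {b} eq = arc-≡
      (injective _ _ (trans (sym (proj₁ (ends a))) (trans (cong (tail D) eq) (proj₁ (ends b)))))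
      (injective _ _ (trans (sym (proj₂ (ends a))) (trans (cong (head D) eq) (proj₂ (ends b)))))
    -- For the ends of `e`, `image` returns some arc of `S`, not visibly `e` itself; `simple`
    -- identifies the two.
    ψ-onto : ∀ e → lookup S e ≡ true → ∃[ a ] ψ a ≡ e
    ψ-onto e e∈S with preimage e e∈S
    ... | x , y , p , t , h with image x y p in eq
    ...   | e′ , e′∈S , t′ , h′ = ((x , y) , p) , trans (cong proj₁ eq)
      (simple e′ e e′∈S e∈S (trans t′ (sym t)) (trans h′ (sym h)))

  copy⇒vertexMap : IsCopy H D U S → ∃ VertexMap
  copy⇒vertexMap (φ , ψ , φ-inj , ψ-inj , ends , verts , arcs) = tabulate φ , record
    { injective = λ x y eq → φ-inj (trans (sym (φ≡ x)) (trans eq (φ≡ y)))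
    ; onto      = λ v v∈U → let (x , eq) = Equivalence.to (verts v) v∈U in x , trans (φ≡ x) eq
    ; into      = λ x → Equivalence.from (verts _) (x , sym (φ≡ x))
    ; image     = λ x y p → let a = (x , y) , p in
        ψ a , Equivalence.from (arcs _) (a , refl) ,
        trans (proj₁ (ends a)) (sym (φ≡ x)) , trans (proj₂ (ends a)) (sym (φ≡ y))
    ; preimage  = λ e e∈S → pre e (Equivalence.to (arcs e) e∈S)
    ; simple    = λ e e′ e∈S e′∈S → unique (Equivalence.to (arcs e) e∈S) (Equivalence.to (arcs e′) e′∈S)
    }
    where
    φ≡ : ∀ x → lookup (tabulate φ) x ≡ φ x
    φ≡ = lookup∘tabulate φ
    pre : ∀ e → ∃[ a ] ψ a ≡ e → ∃[ x ] ∃[ y ] (adj H x y ≡ true ×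
      tail D e ≡ lookup (tabulate φ) x × head D e ≡ lookup (tabulate φ) y)
    pre e (a@((x , y) , p) , refl) =
      x , y , p , trans (proj₁ (ends a)) (sym (φ≡ x)) , trans (proj₂ (ends a)) (sym (φ≡ y))
    unique : ∀ {e e′} → ∃[ a ] ψ a ≡ e → ∃[ a ] ψ a ≡ e′ → tail D e ≡ tail D e′ → head D e ≡ head D e′ → e ≡ e′
    unique (a , refl) (b , refl) t h = cong ψ (arc-≡
      (φ-inj (trans (sym (proj₁ (ends a))) (trans t (proj₁ (ends b)))))
      (φ-inj (trans (sym (proj₂ (ends a))) (trans h (proj₂ (ends b))))))

  -- Decidability allows the copies to be listed, so that the packing program has finitely many
  -- explicit variables.
  isCopy? : Dec (IsCopy H D U S)
  isCopy? = map′ vertexMap⇒copy copy⇒vertexMap (∃Vec? (nV H) vertexMap?)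

-- Sums over subsets, and packings as functions on subgraphs

subsets : ∀ n → List (Subset n)
subsets zero    = [] ∷ []
subsets (suc n) = map (outside ∷_) (subsets n) ++ map (inside ∷_) (subsets n)

∈-subsets : ∀ {n} (s : Subset n) → s ∈ subsets n
∈-subsets []          = here refl
∈-subsets (false ∷ s) = ∈-++⁺ˡ (∈-map⁺ (outside ∷_) (∈-subsets s))
∈-subsets {suc n} (true ∷ s) = ∈-++⁺ʳ (map (outside ∷_) (subsets n)) (∈-map⁺ (inside ∷_) (∈-subsets s))

∑Sub-cong : ∀ n {f g : Subset n → ℚ} → (∀ s → f s ≡ g s) → ∑Sub n f ≡ ∑Sub n g
∑Sub-cong zero    eq = eq []
∑Sub-cong (suc n) eq = cong₂ _+_ (∑Sub-cong n λ s → eq (outside ∷ s)) (∑Sub-cong n λ s → eq (inside ∷ s))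

∑Sub-*ˡ : ∀ n k (f : Subset n → ℚ) → ∑Sub n (λ s → k * f s) ≡ k * ∑Sub n f
∑Sub-*ˡ zero    k f = refl
∑Sub-*ˡ (suc n) k f = trans (cong₂ _+_ (∑Sub-*ˡ n k _) (∑Sub-*ˡ n k _)) (sym (*-distribˡ-+ k (∑Sub n _) (∑Sub n _)))

∑Sub-∑ℚ : ∀ n N (f : Fin N → Subset n → ℚ) →
  ∑Sub n (λ s → ∑ℚ N (λ i → f i s)) ≡ ∑ℚ N (λ i → ∑Sub n (f i))
∑Sub-∑ℚ zero    N f = refl
∑Sub-∑ℚ (suc n) N f = trans (cong₂ _+_ (∑Sub-∑ℚ n N (λ i s → f i (outside ∷ s))) (∑Sub-∑ℚ n N (λ i s → f i (inside ∷ s)))) (sym (∑ℚ-+ N _ _))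

σ : ∀ {n} → Subset n → Subset n → ℚ
σ s t = ι (does (≡-dec Bool._≟_ s t))

∑Sub-0 : ∀ n (f : Subset n → ℚ) → ∑Sub n (λ s → 0ℚ * f s) ≡ 0ℚ
∑Sub-0 n f = trans (∑Sub-*ˡ n 0ℚ f) (*-zeroˡ (∑Sub n f))

∑Sub-σ : ∀ {n} (t : Subset n) (f : Subset n → ℚ) → ∑Sub n (λ s → σ t s * f s) ≡ f t
∑Sub-σ []          f = *-identityˡ (f [])
∑Sub-σ {suc n} (false ∷ t) f = trans (cong₂ _+_ (∑Sub-σ t (λ s → f (outside ∷ s))) (∑Sub-0 n (λ s → f (inside ∷ s)))) (+-identityʳ _)
∑Sub-σ {suc n} (true ∷ t)  f = trans (cong₂ _+_ (∑Sub-0 n (λ s → f (outside ∷ s))) (∑Sub-σ t (λ s → f (inside ∷ s)))) (+-identityˡ _)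

if-*ι : ∀ b x → (if b then x else 0ℚ) ≡ ι b * x
if-*ι true  x = sym (*-identityˡ x)
if-*ι false x = sym (*-zeroˡ x)

module Spread {a b N} (X : Fin N → Subset a × Subset b) (m : Fin N → ℚ) where

  spread : Subset a → Subset b → ℚ
  spread U S = ∑ℚ N (λ i → σ (proj₁ (X i)) U * (σ (proj₂ (X i)) S * m i))

  spread-nonNeg : (∀ i → 0ℚ ≤ m i) → ∀ U S → 0ℚ ≤ spread U S
  spread-nonNeg 0≤m U S = ∑ℚ-nonNeg N λ i →
    *-nonNeg (0≤ι (does (≡-dec Bool._≟_ (proj₁ (X i)) U))) (*-nonNeg (0≤ι (does (≡-dec Bool._≟_ (proj₂ (X i)) S))) (0≤m i))

  spread-outside : ∀ U S → (∀ i → X i ≢ (U , S)) → spread U S ≡ 0ℚ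
  spread-outside U S ∉X = trans (∑ℚ-cong N λ i → go i (≡-dec Bool._≟_ (proj₁ (X i)) U) (≡-dec Bool._≟_ (proj₂ (X i)) S)) (∑ℚ-zero N)
    where
    go : ∀ i (d : Dec (proj₁ (X i) ≡ U)) (d′ : Dec (proj₂ (X i) ≡ S)) → ι (does d) * (ι (does d′) * m i) ≡ 0ℚ
    go i (no  _)  d′      = *-zeroˡ (ι (does d′) * m i)
    go i (yes _)  (no  _) = trans (*-identityˡ _) (*-zeroˡ (m i))
    go i (yes eq) (yes eq′) = contradiction (cong₂ _,_ eq eq′) (∉X i)

  -- The test `β` serves two purposes: membership of an arc in `S` gives the load on that arc, and
  -- the constant `true` gives the packing value.
  ∑-spread : ∀ (β : Subset a → Subset b → Bool) →
    ∑Sub a (λ U → ∑Sub b (λ S → if β U S then spread U S else 0ℚ)) ≡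
    ∑ℚ N (λ i → ι (β (proj₁ (X i)) (proj₂ (X i))) * m i)
  ∑-spread β = begin
    ∑Sub a (λ U → ∑Sub b (λ S → if β U S then spread U S else 0ℚ))
      ≡⟨ ∑Sub-cong a (λ U → trans (∑Sub-cong b (λ S → push U S)) (∑Sub-∑ℚ b N _)) ⟩
    ∑Sub a (λ U → ∑ℚ N (λ i → ∑Sub b (λ S → σ (proj₁ (X i)) U * (σ (proj₂ (X i)) S * (ι (β U S) * m i)))))
      ≡⟨ ∑Sub-cong a (λ U → ∑ℚ-cong N λ i → trans (∑Sub-*ˡ b (σ (proj₁ (X i)) U) _)
           (cong (σ (proj₁ (X i)) U *_) (∑Sub-σ (proj₂ (X i)) (λ S → ι (β U S) * m i)))) ⟩
    ∑Sub a (λ U → ∑ℚ N (λ i → σ (proj₁ (X i)) U * (ι (β U (proj₂ (X i))) * m i)))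
      ≡⟨ ∑Sub-∑ℚ a N _ ⟩
    ∑ℚ N (λ i → ∑Sub a (λ U → σ (proj₁ (X i)) U * (ι (β U (proj₂ (X i))) * m i)))
      ≡⟨ ∑ℚ-cong N (λ i → ∑Sub-σ (proj₁ (X i)) (λ U → ι (β U (proj₂ (X i))) * m i)) ⟩
    ∑ℚ N (λ i → ι (β (proj₁ (X i)) (proj₂ (X i))) * m i) ∎
    where
    open ≡-Reasoning
    shuffle : ∀ c u s m → c * (u * (s * m)) ≡ u * (s * (c * m))
    shuffle = solve-∀ ℚ-ring
    push : ∀ U S → (if β U S then spread U S else 0ℚ) ≡
      ∑ℚ N (λ i → σ (proj₁ (X i)) U * (σ (proj₂ (X i)) S * (ι (β U S) * m i)))
    push U S = trans (if-*ι (β U S) (spread U S)) (trans (sym (∑ℚ-*ˡ N (ι (β U S)) _))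
      (∑ℚ-cong N λ i → shuffle (ι (β U S)) (σ (proj₁ (X i)) U) (σ (proj₂ (X i)) S) (m i)))

-- Counting the arcs of a copy

∑-positive : ∀ n {f : Fin n → ℕ} → 1 ℕ.≤ ∑ n f → ∃[ i ] 1 ℕ.≤ f i
∑-positive (suc n) {f} le with f zero in eq
... | suc _ = zero , subst (1 ℕ.≤_) (sym eq) (s≤s z≤n)
... | zero  with ∑-positive n le
...   | i , 1≤fi = suc i , 1≤fi

∃-arc : (G : Digraph) → 1 ℕ.≤ arcCount G → Arc G
∃-arc G 1≤ with ∑-positive (nV G) 1≤
... | x , 1≤x with ∑-positive (nV G) 1≤x
...   | y , 1≤y with adj G x y in eq
...     | true = (x , y) , eq

∑∑ : ∀ n → (Fin n → Fin n → Bool) → ℚ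
∑∑ n κ = ∑ℚ n (λ x → ∑ℚ n (λ y → ι (κ x y)))

ℕ→ℚ-∑∑ : ∀ n κ → ℕ→ℚ (∑ n λ x → ∑ n λ y → if κ x y then 1 else 0) ≡ ∑∑ n κ
ℕ→ℚ-∑∑ n κ = trans (ℕ→ℚ-∑ n _) (∑ℚ-cong n λ x → trans (ℕ→ℚ-∑ n _) (∑ℚ-cong n λ y → ℕ→ℚ-if (κ x y)))

length-filter-tabulate : ∀ {A : Set} (b : A → Bool) n (f : Fin n → A) →
  length (filter (λ a → b a Bool.≟ true) (List.tabulate f)) ≡ ∑ n (λ i → if b (f i) then 1 else 0)
length-filter-tabulate b zero    f = refl
length-filter-tabulate b (suc n) f with b (f zero)
... | true  = cong suc (length-filter-tabulate b n _)
... | false = length-filter-tabulate b n _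

length-filter-product : ∀ {A B : Set} (b : A × B → Bool) m n (f : Fin m → A) (g : Fin n → B) →
  length (filter (λ p → b p Bool.≟ true) (cartesianProduct (List.tabulate f) (List.tabulate g))) ≡
  ∑ m (λ x → ∑ n λ y → if b (f x , g y) then 1 else 0)
length-filter-product b zero    n f g = refl
length-filter-product b (suc m) n f g = begin
  length (filter P? (map (f zero ,_) (List.tabulate g) ++ rest))
    ≡⟨ cong length (filter-++ P? (map (f zero ,_) (List.tabulate g)) rest) ⟩
  length (filter P? (map (f zero ,_) (List.tabulate g)) ++ filter P? rest)
    ≡⟨ length-++ (filter P? (map (f zero ,_) (List.tabulate g))) ⟩
  length (filter P? (map (f zero ,_) (List.tabulate g))) ℕ.+ length (filter P? rest)
    ≡⟨ cong₂ ℕ._+_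
        (trans (cong (length ∘ filter P?) (map-tabulate g (f zero ,_))) (length-filter-tabulate b n _))
        (length-filter-product b m n (f ∘ suc) g) ⟩
  ∑ (suc m) (λ x → ∑ n λ y → if b (f x , g y) then 1 else 0) ∎
  where
  open ≡-Reasoning
  P? = λ p → b p Bool.≟ true
  rest = cartesianProduct (List.tabulate (f ∘ suc)) (List.tabulate g)

-- Adding to B(L) the images of the missed arcs creates a copy of `H`. The map `ρ` may identify
-- vertices, but each part of the blowup is infinite, so the index `toℕ x` separates them.
disc≤missed : ∀ (H L : Digraph) {d} → IsDisc H L d → (ρ : Fin (nV H) → Fin (nV L)) →
  d ℕ.≤ ∑ (nV H) (λ x → ∑ (nV H) λ y → if adj H x y ∧ not (adj L (ρ x) (ρ y)) then 1 else 0)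
disc≤missed H L {d} (_ , minimal) ρ =
  subst (d ℕ.≤_) (trans (length-map both missed) (length-filter-product b (nV H) (nV H) id id))
    (minimal (map both missed) (unique , All.tabulate valid) (φ , φ-injective , contains))
  where
  φ : Fin (nV H) → BVert L
  φ x = ρ x , toℕ x
  φ-injective : Injective _≡_ _≡_ φ
  φ-injective eq = toℕ-injective (cong proj₂ eq)
  both : Fin (nV H) × Fin (nV H) → BVert L × BVert L
  both (x , y) = φ x , φ y
  both-injective : Injective _≡_ _≡_ both
  both-injective eq = cong₂ _,_ (φ-injective (cong proj₁ eq)) (φ-injective (cong proj₂ eq))
  b : Fin (nV H) × Fin (nV H) → Bool
  b (x , y) = adj H x y ∧ not (adj L (ρ x) (ρ y))
  P? = λ p → b p Bool.≟ true
  pairs = cartesianProduct (allFin (nV H)) (allFin (nV H))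
  missed = filter P? pairs
  unique : Unique (map both missed)
  unique = Unique.map⁺ both-injective (Unique.filter⁺ P?
    (Unique.cartesianProduct⁺ (Unique.allFin⁺ (nV H)) (Unique.allFin⁺ (nV H))))
  ∧-not : ∀ {c c′} → c ∧ not c′ ≡ true → c ≡ true × c′ ≡ false
  ∧-not {true} {false} _ = refl , refl
  valid : ∀ {p} → p ∈ map both missed → proj₁ p ≢ proj₂ p × ¬ BArc L (proj₁ p) (proj₂ p)
  valid p∈ with ∈-map⁻ both p∈
  ... | (x , y) , xy∈ , refl with ∧-not (proj₂ (∈-filter⁻ P? {xs = pairs} xy∈))
  ...   | Hxy , Lxy = distinct , λ arc → contradiction (trans (sym arc) Lxy) λ ()
    where
    distinct : φ x ≢ φ y
    distinct eq with φ-injective {x} {y} eq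
    ... | refl = contradiction (trans (sym Hxy) (loopless H x)) λ ()
  contains : ∀ x y → adj H x y ≡ true → BArc L (φ x) (φ y) ⊎ (φ x , φ y) ∈ map both missed
  contains x y Hxy with adj L (ρ x) (ρ y) in eq
  ... | true  = inj₁ refl
  ... | false = inj₂ (∈-map⁺ both (∈-filter⁺ P? {xs = pairs}
    (∈-cartesianProduct⁺ (∈-allFin x) (∈-allFin y)) (cong₂ (λ c c′ → c ∧ not c′) Hxy eq)))

module CopyArcs (H : Digraph) (D : WMultigraph) (U : Subset (nVert D)) (S : Subset (nArc D)) (copy : IsCopy H D U S) where

  private
    n = nV H
    E = nArc D
    φ = proj₁ copy
    ψ = proj₁ (proj₂ copy)
    ends = proj₁ (proj₂ (proj₂ (proj₂ (proj₂ copy))))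
    arcs = proj₂ (proj₂ (proj₂ (proj₂ (proj₂ (proj₂ copy)))))

    -- Indicator of the arc assigned to a pair of vertices of `H`, and 0 if the pair is not
    -- adjacent. Abstracting the Boolean `b` makes the adjacency proof available exactly when it is
    -- `true`.
    hat : ∀ b → (b ≡ true → Fin E) → Fin E → ℚ
    hat true  f e = δ (f refl) e
    hat false f e = 0ℚ

    ∑-hat : ∀ b f k → ∑ℚ E (λ e → hat b f e * ι k) ≡ ι (b ∧ k)
    ∑-hat true  f k = ∑ℚ-δ (f refl) (λ _ → ι k)
    ∑-hat false f k = ∑ℚ-0* E (λ _ → ι k)

    0≤hat : ∀ b f e → 0ℚ ≤ hat b f e
    0≤hat true  f e = 0≤ι _
    0≤hat false f e = ≤-refl

    hat-self : ∀ b f (p : b ≡ true) → hat b f (f p) ≡ 1ℚ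
    hat-self true f refl = cong ι (dec-true (f refl ≟ᶠ f refl) refl)

  -- Every arc of `S` is the image of an arc of `H` with corresponding ends and is charged to it.
  -- The test `κ` is constantly `true` for the size of the copy, and adjacency in `L` for the part
  -- of it kept by a map.
  copy-count : (κ : Fin (nVert D) → Fin (nVert D) → Bool) →
    ∑ℚ E (λ e → ι (lookup S e ∧ κ (tail D e) (head D e))) ≤ ∑∑ n (λ x y → adj H x y ∧ κ (φ x) (φ y))
  copy-count κ = begin
    ∑ℚ E (λ e → ι (lookup S e ∧ κ (tail D e) (head D e)))           ≤⟨ ∑ℚ-mono E charge ⟩
    ∑ℚ E (λ e → ∑ℚ n (λ x → ∑ℚ n (λ y → share x y e)))              ≡⟨ ∑ℚ-swap E n _ ⟩
    ∑ℚ n (λ x → ∑ℚ E (λ e → ∑ℚ n (λ y → share x y e)))              ≡⟨ ∑ℚ-cong n (λ x → ∑ℚ-swap E n _) ⟩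
    ∑ℚ n (λ x → ∑ℚ n (λ y → ∑ℚ E (share x y)))
      ≡⟨ ∑ℚ-cong n (λ x → ∑ℚ-cong n λ y → ∑-hat (adj H x y) (λ p → ψ ((x , y) , p)) (κ (φ x) (φ y))) ⟩
    ∑∑ n (λ x y → adj H x y ∧ κ (φ x) (φ y))                        ∎
    where
    open ≤-Reasoning
    share : Fin n → Fin n → Fin E → ℚ
    share x y e = hat (adj H x y) (λ p → ψ ((x , y) , p)) e * ι (κ (φ x) (φ y))
    0≤share : ∀ x y e → 0ℚ ≤ share x y e
    0≤share x y e = *-nonNeg (0≤hat (adj H x y) _ e) (0≤ι _)
    charge : ∀ e → ι (lookup S e ∧ κ (tail D e) (head D e)) ≤ ∑ℚ n (λ x → ∑ℚ n (λ y → share x y e))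
    charge e with lookup S e in e∈S
    ... | false = ∑ℚ-nonNeg n λ x → ∑ℚ-nonNeg n λ y → 0≤share x y e
    ... | true with Equivalence.to (arcs e) e∈S
    ...   | ((x , y) , p) , refl = ≤-trans
      (≤-reflexive (sym (trans (cong₂ _*_ (hat-self (adj H x y) _ p)
        (cong ι (sym (cong₂ κ (proj₁ (ends _)) (proj₂ (ends _)))))) (*-identityˡ _))))
      (≤-trans (term≤∑ℚ n (λ y → 0≤share x y e) y)
        (term≤∑ℚ n (λ x → ∑ℚ-nonNeg n λ y → 0≤share x y e) x))

  copy-size : ∑ℚ E (λ e → ι (lookup S e)) ≤ ℕ→ℚ (arcCount H)
  copy-size = subst₂ _≤_ (∑ℚ-cong E λ e → cong ι (Bool.∧-identityʳ (lookup S e)))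
    (trans (∑ℚ-cong n λ x → ∑ℚ-cong n λ y → cong ι (Bool.∧-identityʳ (adj H x y))) (sym (ℕ→ℚ-∑∑ n (adj H))))
    (copy-count (λ _ _ → true))

  -- The composite map from V(H) through V(D) to V(L) misses at least `d` arcs of `H`, and kept and
  -- missed arcs together are all of them.
  copy-size-kept : ∀ L {d} → IsDisc H L d → (π : Fin (nVert D) → Fin (nV L)) →
    ∑ℚ E (λ e → ι (lookup S e ∧ adj L (π (tail D e)) (π (head D e)))) ≤ ℕ→ℚ (arcCount H) - ℕ→ℚ d
  copy-size-kept L {d} disc π = ≤-trans (copy-count κ) (begin
    kept                                ≡⟨ cancel kept missed ⟩
    (kept + missed) - missed            ≡⟨ cong (_- missed) total ⟩
    ℕ→ℚ (arcCount H) - missed           ≤⟨ +-monoʳ-≤ (ℕ→ℚ (arcCount H)) (neg-antimono-≤ d≤missed) ⟩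
    ℕ→ℚ (arcCount H) - ℕ→ℚ d            ∎)
    where
    open ≤-Reasoning
    κ : Fin (nVert D) → Fin (nVert D) → Bool
    κ u v = adj L (π u) (π v)
    kept missed : ℚ
    kept   = ∑∑ n (λ x y → adj H x y ∧ κ (φ x) (φ y))
    missed = ∑∑ n (λ x y → adj H x y ∧ not (κ (φ x) (φ y)))
    cancel : ∀ a b → a ≡ (a + b) - b
    cancel = solve-∀ ℚ-ring
    ι-split : ∀ b c → ι (b ∧ c) + ι (b ∧ not c) ≡ ι b
    ι-split true  true  = refl
    ι-split true  false = refl
    ι-split false c     = refl
    total : kept + missed ≡ ℕ→ℚ (arcCount H)
    total = trans (sym (∑ℚ-+ n _ _)) (trans (∑ℚ-cong n λ x → trans (sym (∑ℚ-+ n _ _))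
      (∑ℚ-cong n λ y → ι-split (adj H x y) (κ (φ x) (φ y)))) (sym (ℕ→ℚ-∑∑ n (adj H))))
    d≤missed : ℕ→ℚ d ≤ missed
    d≤missed = subst (ℕ→ℚ d ≤_) (ℕ→ℚ-∑∑ n _) (ℕ→ℚ-mono (disc≤missed H L disc (λ x → π (φ x))))

  copy-arc : 1 ℕ.≤ arcCount H → ∃[ e ] lookup S e ≡ true
  copy-arc 1≤ = ψ a , Equivalence.from (arcs (ψ a)) (a , refl)
    where a = ∃-arc H 1≤

-- From the incidence matrix of copies back to the multigraph

record Enumeration (H : Digraph) (D : WMultigraph) : Set where
  field
    N        : ℕ
    X        : Fin N → Subset (nVert D) × Subset (nArc D)
    isCopy   : ∀ i → IsCopy H D (proj₁ (X i)) (proj₂ (X i))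
    complete : ∀ U S → IsCopy H D U S → ∃[ i ] (U , S) ≡ X i

enumeration : ∀ H D → Enumeration H D
enumeration H D = record
  { N = length copies
  ; X = List.lookup copies
  ; isCopy = λ i → proj₂ (∈-filter⁻ copyPair? {xs = pairs} (∈-lookup {xs = copies} i))
  ; complete = λ U S c → let US∈ = listed U S c in index US∈ , lookup-index US∈ }
  where
  copyPair? = λ (p : Subset (nVert D) × Subset (nArc D)) → isCopy? H D (proj₁ p) (proj₂ p)
  pairs = cartesianProduct (subsets (nVert D)) (subsets (nArc D))
  copies = filter copyPair? pairs
  listed : ∀ U S → IsCopy H D U S → (U , S) ∈ copies
  listed U S c = ∈-filter⁺ copyPair? {xs = pairs} (∈-cartesianProduct⁺ (∈-subsets U) (∈-subsets S)) c

module _ {H D} (enum : Enumeration H D) where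

  open Enumeration enum

  private
    A : Fin N → Fin (nArc D) → Bool
    A i = lookup (proj₂ (X i))

  HitAndPack : ℚ → Set
  HitAndPack f = ∃ λ (F : Fin (nArc D) → Bool) → ((∀ i → ∃[ e ] (A i e ≡ true × F e ≡ true)) ×
    ∃[ m ] (Packing N (nArc D) (λ i e → ι (A i e)) (w D) m ×
      ∑ℚ (nArc D) (λ e → ι (F e) * w D e) ≤ f * ∑ℚ N m))

  hitAndPack : ∀ L d → 1 ℕ.≤ arcCount H → 1 ℕ.≤ arcCount L → IsDisc H L d → HitAndPack (fHL H L d)
  -- The case of no vertices cannot occur: there `1 ≤ arcCount L` reduces to `1 ≤ 0`.
  hitAndPack L@(record { nV = suc k ; adj = adjᴸ }) d 1≤H _ disc =
    Rounding.rounding A T h (h - ℕ→ℚ d) (missProb adjᴸ) (fHL H L d)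
      (λ i → Copy.copy-arc i 1≤H)
      Copy.copy-size
      kept
      (0≤ℕ→ℚ (arcCount H)) (0≤missProb adjᴸ)
      (∃-cheap-map adjᴸ (tail D) (head D) (noLoop D))
      (subst (λ q → h * q ≤ fHL H L d) (sym (missProb≡ adjᴸ))
        (p≤p⊔q (h * (1ℚ - density (arcCount L) (suc k))) (h - ℕ→ℚ d)))
      (p≤q⊔p (h * (1ℚ - density (arcCount L) (suc k))) (h - ℕ→ℚ d))
      (w D) (w≥0 D)
    where
    open Average k
    module Copy (i : Fin N) = CopyArcs H D (proj₁ (X i)) (proj₂ (X i)) (isCopy i)
    h = ℕ→ℚ (arcCount H)
    T : Vec (Fin (suc k)) (nVert D) → Fin (nArc D) → Bool
    T π e = not (adjᴸ (lookup π (tail D e)) (lookup π (head D e)))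
    kept : ∀ π i → ∑ℚ (nArc D) (λ e → ι (A i e ∧ not (T π e))) ≤ h - ℕ→ℚ d
    kept π i = subst (_≤ h - ℕ→ℚ d)
      (∑ℚ-cong (nArc D) λ e → cong (λ c → ι (A i e ∧ c)) (sym (Bool.not-involutive _)))
      (Copy.copy-size-kept i L disc (lookup π))

  toSubgraphs : ∀ f → HitAndPack f →
    ∃[ F ] (Hitting H D F × ∃[ m ] (FracPacking H D m × weightOf D F ≤ f * packingValue D m))
  toSubgraphs f (F , hits , m , (0≤m , load≤w) , bound) =
    tabulate F , hitting , spread ,
    (spread-nonNeg 0≤m , outside-zero , packs) ,
    subst₂ _≤_ (sym (∑ℚ-cong (nArc D) weight)) (cong (f *_) (sym value)) bound
    where
    open Spread X m
    hitting : Hitting H D (tabulate F)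
    hitting U S c =
      let (i , eq) = complete U S c
          (e , e∈S , Fe) = hits i
      in e , trans (cong (λ p → lookup (proj₂ p) e) eq) e∈S , trans (lookup∘tabulate F e) Fe
    outside-zero : ∀ U S → ¬ IsCopy H D U S → spread U S ≡ 0ℚ
    outside-zero U S ¬c = spread-outside U S λ i eq →
      ¬c (subst (λ p → IsCopy H D (proj₁ p) (proj₂ p)) eq (isCopy i))
    packs : ∀ e → ∑Sub (nVert D) (λ U → ∑Sub (nArc D) λ S → if lookup S e then spread U S else 0ℚ) ≤ w D e
    packs e = subst (_≤ w D e) (sym (∑-spread (λ _ S → lookup S e))) (load≤w e)
    value : packingValue D spread ≡ ∑ℚ N m
    value = trans (∑-spread (λ _ _ → true)) (∑ℚ-cong N λ i → *-identityˡ (m i))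
    weight : ∀ e → (if lookup (tabulate F) e then w D e else 0ℚ) ≡ ι (F e) * w D e
    weight e = trans (cong (λ b → if b then w D e else 0ℚ) (lookup∘tabulate F e)) (if-*ι (F e) (w D e))

-- The weight of `F` bounds τ from above, the value of `m` bounds ν* from below, and f(H,L) is
-- non-negative. Since `L` is arbitrary, the infimum over `L` can be taken afterwards with `D`
-- fixed.
theorem1p7 : (H : Digraph) → 2 ℕ.≤ arcCount H → (D : WMultigraph) →
    (L : Digraph) → 1 ℕ.≤ arcCount L → (d : ℕ) → IsDisc H L d →
    ∃[ F ] (Hitting H D F × ∃[ m ] (FracPacking H D m ×
    Data.Rational._≤_ (weightOf D F) (fHL H L d * packingValue D m)))
theorem1p7 H 2≤H D L 1≤L d disc = toSubgraphs enum (fHL H L d) (hitAndPack enum L d (ℕ.<⇒≤ 2≤H) 1≤L disc)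
  where enum = enumeration H D
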